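{- Let $C_1, C_2>0$ and $0<\varepsilon<1$ be constants. There are constants $K=K(C_1,C_2,\varepsilon)$ and $L=L(\varepsilon)$ such that the following holds for all $n$ and every $\rho\ge n^{ -C_2}$: the number $N$ of multi-sets $A=\{a_1,\dots,a_n\}$ of $n$ integers with $\max_i |a_i|\le n^{C_1}$ and $\rho(A)\ge \rho$ satisfies $$N\le K^n\, n^{Ln}\,\big(\rho^{ -1} n^{ -1/2}\big)^n .$$
   Context: For a multi-set $A=\{a_1,\dots,a_n\}$ of integers, $\rho(A):=\sup_{x\in\mathbb{R}}\mathbb{P}(a_1\xi_1+\dots+a_n\xi_n=x)$, where $\xi_1,\dots,\xi_n$ are independent Bernoulli random variables taking values $\pm1$ with probability $1/2$ each. -}

module Defs where

open import Data.Bool using (Bool; true; false; _∧_)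
open import Data.Nat as ℕ using (ℕ; zero; suc)
open import Data.Integer as ℤ using (ℤ; +_; -[1+_]; ∣_∣)
open import Data.Integer.Properties as ℤP using ()
open import Data.Rational as ℚ using (ℚ; 0ℚ; 1ℚ)
open import Data.List using (List; []; _∷_; map; _++_; length; filterᵇ; foldr; upTo; concatMap)
open import Relation.Nullary.Decidable using (⌊_⌋)

_^ℚ_ : ℚ → ℕ → ℚ
p ^ℚ zero  = 1ℚ
p ^ℚ suc k = p ℚ.* (p ^ℚ k)

ℕtoℚ : ℕ → ℚ
ℕtoℚ m = (+ m) ℚ./ 1

signs : ℕ → List (List ℤ)
signs zero    = [] ∷ []
signs (suc n) = concatMap (λ ξ → (ℤ.+ 1 ∷ ξ) ∷ (ℤ.-[1+ 0 ] ∷ ξ) ∷ []) (signs n)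

dot : List ℤ → List ℤ → ℤ
dot (a ∷ as) (x ∷ xs) = a ℤ.* x ℤ.+ dot as xs
dot _        _        = ℤ.0ℤ

-- number of sign vectors ξ with Σ aᵢξᵢ = x  (= 2ⁿ · P(Σ aᵢξᵢ = x))
atoms : List ℤ → ℤ → ℕ
atoms A x = length (filterᵇ (λ ξ → ⌊ dot A ξ ℤP.≟ x ⌋) (signs (length A)))

-- sup over x of the atom counts; the supremum over x ∈ ℝ is attained at one
-- of the finitely many values Σ aᵢξᵢ (all other x have probability 0)
maxAtom : List ℤ → ℕ
maxAtom A = foldr ℕ._⊔_ 0 (map (λ ξ → atoms A (dot A ξ)) (signs (length A)))

-- ρ(A) = sup_x P(a₁ξ₁+…+aₙξₙ = x) = maxAtom A / 2ⁿ
ρ : List ℤ → ℚ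
ρ A = ℕtoℚ (maxAtom A) ℚ.* ((ℤ.+ 1 ℚ./ 2) ^ℚ length A)

range : ℕ → List ℤ
range B = map (λ i → (+ i) ℤ.- (+ B)) (upTo (suc (B ℕ.+ B)))

-- all multisets of size n with elements from the list vs, each represented
-- exactly once as a list in the (weakly increasing) order of vs
multisets : List ℤ → ℕ → List (List ℤ)
multisets vs       zero    = [] ∷ []
multisets []       (suc n) = []
multisets (v ∷ vs) (suc n) = map (v ∷_) (multisets (v ∷ vs) n) ++ multisets vs (suc n)

-- |a| ≤ n^(s/t)  ⇔  |a|^t ≤ n^s
boundedᵇ : ℕ → ℕ → ℕ → ℤ → Bool
boundedᵇ n s t a = (∣ a ∣ ℕ.^ t) ℕ.≤ᵇ (n ℕ.^ s)

allᵇ : {X : Set} → (X → Bool) → List X → Bool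
allᵇ p []       = true
allᵇ p (x ∷ xs) = p x ∧ allᵇ p xs

-- N = number of multisets A = {a₁,…,aₙ} of n integers with
-- max |aᵢ| ≤ n^(s/t) and ρ(A) ≥ r.
-- (Elements are drawn from [-n^s, n^s], which contains every integer
-- with |a| ≤ n^(s/t) when n ≥ 1, t ≥ 1.)
count : ℕ → ℕ → ℕ → ℚ → ℕ
count n s t r =
  length (filterᵇ (λ A → allᵇ (boundedᵇ n s t) A ∧ (r ℚ.≤ᵇ ρ A))
                  (multisets (range (n ℕ.^ s)) n))

module Submission where

-- Let U(A) be the probability that Σ 2aᵢηᵢ = 0, where the ηᵢ are independent, 0 with probability
-- 3/4 and ±1 with probability 1/8 each.  Then ρ(A) ≤ U(A).  Over ℝ this follows from
-- |cos θ| ≤ 3/4 + cos(2θ)/4; here it is a sum-of-squares identity between positive definite functions on ℤ,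
-- which also shows that the law of Σ 2aᵢηᵢ is maximal at 0.
--
-- Adding an element a to A gives U(a ∷ A) = (3/4) U(A) + (1/4) P(Σ 2aᵢηᵢ = 2a), and the terms
-- P(Σ 2aᵢηᵢ = 2a) sum to at most 1 over distinct a.  By convexity of x ↦ xᵐ⁺¹, the sum of
-- U(a ∷ A)ᵐ⁺¹ over M values of a is at most U(A)ᵐ (1 + M (3/4)ᵐ⁺¹) ≤ 2 U(A)ᵐ once M (3/4)ᵐ⁺¹ ≤ 1.
-- Hence, for k of order log M, the sum of U(A)ⁿ⁺ᵏ over all sequences A of length n is at most 2ⁿ,
-- and Markov's inequality, applied to sequences in place of multisets, gives N rⁿ⁺ᵏ ≤ 2ⁿ.  As
-- r⁻¹ ≤ nᶜ and k = O(log n), the factor r⁻ᵏ is at most exponential in n, so L = 1 suffices.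

open import Defs
open import Data.Nat using (ℕ; _≥_; _*_; _+_; _^_)
open import Data.Product using (Σ; _×_)
open import Data.Rational using (ℚ; 0ℚ; 1ℚ; _<_; _≤_)
open import Data.Rational as Q using ()
open import Algebra.Bundles using (CommutativeRing)
open import Data.Bool using (Bool; true; false; if_then_else_; T; _∧_)
open import Data.Bool.Properties using (T-∧)
open import Data.Integer as ℤ using (ℤ; +_; 0ℤ; 1ℤ)
import Data.Integer.Properties as ℤ
open import Data.Integer.Tactic.RingSolver using (solve-∀)
open import Data.List using (List; []; _∷_; _++_; length; map; filter; filterᵇ; concatMap; foldr; upTo)
open import Data.List.Properties using (length-filter; length-map; length-upTo; map-++; map-cong; map-∘)
open import Data.List.Relation.Unary.All as All using (All; []; _∷_)
import Data.List.Relation.Unary.All.Properties as All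
open import Data.List.Relation.Unary.AllPairs using ([]; _∷_)
open import Data.List.Relation.Unary.Unique.Propositional using (Unique)
open import Data.List.Relation.Unary.Unique.Propositional.Properties using (map⁺; upTo⁺)
open import Data.Nat as ℕ using (zero; suc; s≤s; z≤n; _∸_; _⊔_)
open import Data.Nat.ListAction using (sum)
open import Data.Nat.ListAction.Properties using (sum-++)
import Data.Nat.Properties as ℕ
open import Data.Nat.Tactic.RingSolver using () renaming (solve-∀ to solveℕ-∀)
open import Data.Product using (_,_; proj₁; proj₂)
import Data.Rational.Properties as ℚ
import Data.Rational.Unnormalised as ℚᵘ
import Data.Rational.Unnormalised.Properties as ℚᵘ
open import Data.Sum using (inj₁; inj₂)
open import Function using (_∘_; Equivalence)
open import Relation.Binary.PropositionalEquality
open import Relation.Nullary using (Dec; yes; no; ¬?)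
open import Relation.Nullary.Decidable using (⌊_⌋)
open import Relation.Nullary.Negation using (contradiction)
open import Algebra.Properties.AbelianGroup ℤ.+-0-abelianGroup using () renaming (∙-cancelʳ to +-cancelʳ)
open import Algebra.Properties.CommutativeSemigroup
  (CommutativeRing.*-commutativeSemigroup ℚ.+-*-commutativeRing) using (interchange)

-- Positive definite functions on ℤ

-- The pair (c , x) stands for the monomial c zˣ.
Combination : Set
Combination = List (ℤ × ℤ)

conv : (ℤ → ℤ) → Combination → ℤ → ℤ
conv g []            x = 0ℤ
conv g ((c , y) ∷ f) x = c ℤ.* g (x ℤ.- y) ℤ.+ conv g f x

form : (ℤ → ℤ) → Combination → Combination → ℤ
form g []            f = 0ℤ
form g ((c , x) ∷ e) f = c ℤ.* conv g f x ℤ.+ form g e f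

-- Testing on integer combinations suffices: the multipliers applied below and the two-point tests
-- all have integer coefficients, so the whole argument stays inside ℤ.
record PositiveDefinite (g : ℤ → ℤ) : Set where
  constructor positiveDefinite
  field form≥0 : ∀ f → 0ℤ ℤ.≤ form g f f

open PositiveDefinite

infix 4 _≗ᶻ_
_≗ᶻ_ : (ℤ → ℤ) → (ℤ → ℤ) → Set
g ≗ᶻ h = ∀ x → g x ≡ h x

conv-cong : ∀ {g h} → g ≗ᶻ h → ∀ f → conv g f ≗ᶻ conv h f
conv-cong eq []            x = refl
conv-cong eq ((c , y) ∷ f) x = cong₂ (λ u v → c ℤ.* u ℤ.+ v) (eq (x ℤ.- y)) (conv-cong eq f x)

form-cong : ∀ {g h} → g ≗ᶻ h → ∀ e f → form g e f ≡ form h e f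
form-cong eq []            f = refl
form-cong eq ((c , x) ∷ e) f =
  cong₂ (λ u v → c ℤ.* u ℤ.+ v) (conv-cong eq f x) (form-cong eq e f)

positiveDefinite-cong : ∀ {g h} → g ≗ᶻ h → PositiveDefinite g → PositiveDefinite h
positiveDefinite-cong eq pd .form≥0 f = subst (0ℤ ℤ.≤_) (form-cong eq f f) (pd .form≥0 f)

conv-+ : ∀ g h f x → conv (λ y → g y ℤ.+ h y) f x ≡ conv g f x ℤ.+ conv h f x
conv-+ g h []            x = refl
conv-+ g h ((c , y) ∷ f) x =
  trans (cong (λ u → c ℤ.* (g (x ℤ.- y) ℤ.+ h (x ℤ.- y)) ℤ.+ u) (conv-+ g h f x))
        (distribute c (g (x ℤ.- y)) (h (x ℤ.- y)) (conv g f x) (conv h f x))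
  where
  distribute : ∀ c p q u v →
    c ℤ.* (p ℤ.+ q) ℤ.+ (u ℤ.+ v) ≡ (c ℤ.* p ℤ.+ u) ℤ.+ (c ℤ.* q ℤ.+ v)
  distribute = solve-∀

form-+ : ∀ g h e f → form (λ y → g y ℤ.+ h y) e f ≡ form g e f ℤ.+ form h e f
form-+ g h []            f = refl
form-+ g h ((c , x) ∷ e) f =
  trans (cong₂ (λ u v → c ℤ.* u ℤ.+ v) (conv-+ g h f x) (form-+ g h e f))
        (distribute c (conv g f x) (conv h f x) (form g e f) (form h e f))
  where
  distribute : ∀ c p q u v →
    c ℤ.* (p ℤ.+ q) ℤ.+ (u ℤ.+ v) ≡ (c ℤ.* p ℤ.+ u) ℤ.+ (c ℤ.* q ℤ.+ v)
  distribute = solve-∀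

positiveDefinite-+ : ∀ {g h} → PositiveDefinite g → PositiveDefinite h →
                     PositiveDefinite (λ x → g x ℤ.+ h x)
positiveDefinite-+ {g} {h} pg ph .form≥0 f =
  subst (0ℤ ℤ.≤_) (sym (form-+ g h f f)) (ℤ.+-mono-≤ (pg .form≥0 f) (ph .form≥0 f))

-- Adding two squares in `positiveDefinite-step` produces twice the wanted function. The form is
-- additive in `g`, and doubling an integer preserves its sign.
positiveDefinite-halve : ∀ {g} → PositiveDefinite (λ x → g x ℤ.+ g x) → PositiveDefinite g
positiveDefinite-halve {g} pd .form≥0 f
  with form g f f | subst (0ℤ ℤ.≤_) (form-+ g g f f) (pd .form≥0 f)
... | + _ | _ = ℤ.+≤+ z≤n
... | ℤ.-[1+ _ ] | ()

-- act and spread both multiply by α + β (zᵃ + z⁻ᵃ): coefficient functions and combinations, respectively.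
act : ℤ → ℤ → ℤ → (ℤ → ℤ) → ℤ → ℤ
act α β a g x = α ℤ.* g x ℤ.+ β ℤ.* (g (x ℤ.+ a) ℤ.+ g (x ℤ.- a))

spread : ℤ → ℤ → ℤ → Combination → Combination
spread α β a []            = []
spread α β a ((c , x) ∷ f) =
  (c ℤ.* α , x) ∷ (c ℤ.* β , x ℤ.- a) ∷ (c ℤ.* β , x ℤ.+ a) ∷ spread α β a f

minus-minus : ∀ x y a → x ℤ.- (y ℤ.- a) ≡ x ℤ.- y ℤ.+ a
minus-minus = solve-∀

minus-plus : ∀ x y a → x ℤ.- (y ℤ.+ a) ≡ x ℤ.- y ℤ.- a
minus-plus = solve-∀

plus-swap : ∀ x y a → x ℤ.+ a ℤ.- y ≡ x ℤ.- y ℤ.+ a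
plus-swap = solve-∀

minus-swap : ∀ x y a → x ℤ.- a ℤ.- y ≡ x ℤ.- y ℤ.- a
minus-swap = solve-∀

-- The multiplier is invariant under z ↦ z⁻¹, so moving it from the combination to the function does
-- not reflect it.
conv-spread : ∀ α β a g f x → conv g (spread α β a f) x ≡ conv (act α β a g) f x
conv-spread α β a g []            x = refl
conv-spread α β a g ((c , y) ∷ f) x
  rewrite conv-spread α β a g f x | minus-minus x y a | minus-plus x y a =
  collect c α β (g (x ℤ.- y)) (g (x ℤ.- y ℤ.+ a)) (g (x ℤ.- y ℤ.- a)) (conv (act α β a g) f x)
  where
  collect : ∀ c α β p q r u →
    c ℤ.* α ℤ.* p ℤ.+ (c ℤ.* β ℤ.* q ℤ.+ (c ℤ.* β ℤ.* r ℤ.+ u)) ≡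
    c ℤ.* (α ℤ.* p ℤ.+ β ℤ.* (q ℤ.+ r)) ℤ.+ u
  collect = solve-∀

-- Convolution commutes with translations; `form-spread` uses this to move the multiplier off the
-- left argument.
conv-act : ∀ α β a g f x → act α β a (conv g f) x ≡ conv (act α β a g) f x
conv-act α β a g []            x = vanish α β
  where
  vanish : ∀ α β → α ℤ.* 0ℤ ℤ.+ β ℤ.* (0ℤ ℤ.+ 0ℤ) ≡ 0ℤ
  vanish = solve-∀
conv-act α β a g ((c , y) ∷ f) x
  rewrite sym (conv-act α β a g f x) | plus-swap x y a | minus-swap x y a =
  collect c α β (g (x ℤ.- y)) (g (x ℤ.- y ℤ.+ a)) (g (x ℤ.- y ℤ.- a))
    (conv g f x) (conv g f (x ℤ.+ a)) (conv g f (x ℤ.- a))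
  where
  collect : ∀ c α β p q r u v w →
    α ℤ.* (c ℤ.* p ℤ.+ u) ℤ.+ β ℤ.* ((c ℤ.* q ℤ.+ v) ℤ.+ (c ℤ.* r ℤ.+ w)) ≡
    c ℤ.* (α ℤ.* p ℤ.+ β ℤ.* (q ℤ.+ r)) ℤ.+ (α ℤ.* u ℤ.+ β ℤ.* (v ℤ.+ w))
  collect = solve-∀

form-spread : ∀ α β a g e f → form g (spread α β a e) f ≡ form (act α β a g) e f
form-spread α β a g []            f = refl
form-spread α β a g ((c , x) ∷ e) f
  rewrite form-spread α β a g e f | sym (conv-act α β a g f x) =
  collect c α β (conv g f x) (conv g f (x ℤ.- a)) (conv g f (x ℤ.+ a)) (form (act α β a g) e f)
  where
  collect : ∀ c α β p q r u →
    c ℤ.* α ℤ.* p ℤ.+ (c ℤ.* β ℤ.* q ℤ.+ (c ℤ.* β ℤ.* r ℤ.+ u)) ≡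
    c ℤ.* (α ℤ.* p ℤ.+ β ℤ.* (r ℤ.+ q)) ℤ.+ u
  collect = solve-∀

form-spreadʳ : ∀ α β a g e f → form g e (spread α β a f) ≡ form (act α β a g) e f
form-spreadʳ α β a g []            f = refl
form-spreadʳ α β a g ((c , x) ∷ e) f =
  cong₂ (λ u v → c ℤ.* u ℤ.+ v) (conv-spread α β a g f x) (form-spreadʳ α β a g e f)

-- Of the two factors of the squared multiplier, one moves to each argument of the form. What
-- remains is the form of `g` at `spread α β a f` taken twice.
positiveDefinite-act² : ∀ α β a {g} → PositiveDefinite g →
                        PositiveDefinite (act α β a (act α β a g))
positiveDefinite-act² α β a {g} pd .form≥0 f =
  subst (0ℤ ℤ.≤_)
        (trans (form-spread α β a g f (spread α β a f)) (form-spreadʳ α β a (act α β a g) f f))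
        (pd .form≥0 (spread α β a f))

δ : ℤ → ℕ
δ x = if ⌊ x ℤ.≟ 0ℤ ⌋ then 1 else 0

δ-≢0 : ∀ {x} → x ≢ 0ℤ → δ x ≡ 0
δ-≢0 {x} x≢0 with x ℤ.≟ 0ℤ
... | yes x≡0 = contradiction x≡0 x≢0
... | no _    = refl

δᶻ : ℤ → ℤ
δᶻ x = + δ x

deletePoint : ℤ → Combination → Combination
deletePoint x = filter (λ (_ , y) → ¬? (y ℤ.≟ x))

conv-deletePoint : ∀ {x z} → z ≢ x → ∀ f → conv δᶻ f z ≡ conv δᶻ (deletePoint x f) z
conv-deletePoint         z≢x []            = refl
conv-deletePoint {x} {z} z≢x ((c , y) ∷ f) with y ℤ.≟ x
... | no  _    = cong (λ u → c ℤ.* δᶻ (z ℤ.- y) ℤ.+ u) (conv-deletePoint z≢x f)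
... | yes refl rewrite δ-≢0 (z≢x ∘ ℤ.i-j≡0⇒i≡j z x) | ℤ.*-zeroʳ c =
  trans (ℤ.+-identityˡ _) (conv-deletePoint z≢x f)

-- `conv δᶻ e x` is the total coefficient of `e` at `x`, so the form of δ is a sum over points of
-- products of total coefficients. The summand of one point is split off.
form-deletePoint : ∀ x e f → form δᶻ e f ≡
  conv δᶻ e x ℤ.* conv δᶻ f x ℤ.+ form δᶻ (deletePoint x e) (deletePoint x f)
form-deletePoint x []            f = refl
form-deletePoint x ((c , y) ∷ e) f with y ℤ.≟ x
... | yes refl rewrite ℤ.+-inverseʳ x | form-deletePoint x e f =
  collect c (conv δᶻ f x) (conv δᶻ e x) (form δᶻ (deletePoint x e) (deletePoint x f))
  where
  collect : ∀ c p q r → c ℤ.* p ℤ.+ (q ℤ.* p ℤ.+ r) ≡ (c ℤ.* 1ℤ ℤ.+ q) ℤ.* p ℤ.+ r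
  collect = solve-∀
... | no y≢x
  rewrite δ-≢0 (y≢x ∘ sym ∘ ℤ.i-j≡0⇒i≡j x y) | form-deletePoint x e f
        | conv-deletePoint y≢x f =
  collect c (conv δᶻ (deletePoint x f) y) (conv δᶻ e x) (conv δᶻ f x)
    (form δᶻ (deletePoint x e) (deletePoint x f))
  where
  collect : ∀ c p q s r →
    c ℤ.* p ℤ.+ (q ℤ.* s ℤ.+ r) ≡ (c ℤ.* 0ℤ ℤ.+ q) ℤ.* s ℤ.+ (c ℤ.* p ℤ.+ r)
  collect = solve-∀

square-nonNegative : ∀ i → 0ℤ ℤ.≤ i ℤ.* i
square-nonNegative (+ n) = subst (0ℤ ℤ.≤_) (ℤ.pos-* n n) (ℤ.+≤+ z≤n)
square-nonNegative (ℤ.-[1+ n ]) = ℤ.+≤+ z≤n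

positiveDefinite-δ : PositiveDefinite δᶻ
positiveDefinite-δ .form≥0 f = bounded (length f) f ℕ.≤-refl
  where
  -- Deleting a point may remove several entries, so the recursion is on a bound for the length.
  -- Each round contributes one square.
  bounded : ∀ m f → length f ℕ.≤ m → 0ℤ ℤ.≤ form δᶻ f f
  bounded m       []            _         = ℤ.≤-refl
  bounded (suc m) f₀@((c , x) ∷ f) (s≤s len) =
    subst (0ℤ ℤ.≤_) (sym (form-deletePoint x f₀ f₀))
      (ℤ.+-mono-≤ (square-nonNegative (conv δᶻ f₀ x)) (bounded m (deletePoint x f₀) shorter))
    where
    -- The head lies at `x` and is itself deleted, so at most the tail remains.
    shorter : length (deletePoint x f₀) ℕ.≤ m
    shorter with x ℤ.≟ x
    ... | yes _ = ℕ.≤-trans (length-filter (λ (_ , y) → ¬? (y ℤ.≟ x)) f) len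
    ... | no x≢x = contradiction refl x≢x

plus-minus : ∀ x a → x ℤ.+ a ℤ.- a ≡ x
plus-minus = solve-∀

minus-plus-cancel : ∀ x a → x ℤ.- a ℤ.+ a ≡ x
minus-plus-cancel = solve-∀

minus-minus-+ : ∀ x a → x ℤ.- a ℤ.- a ≡ x ℤ.- (a ℤ.+ a)
minus-minus-+ = solve-∀

act² : ∀ α β a g x → act α β a (act α β a g) x ≡
  (α ℤ.* α ℤ.+ (β ℤ.* β ℤ.+ β ℤ.* β)) ℤ.* g x
    ℤ.+ (α ℤ.* β ℤ.+ α ℤ.* β) ℤ.* (g (x ℤ.+ a) ℤ.+ g (x ℤ.- a))
    ℤ.+ β ℤ.* β ℤ.* (g (x ℤ.+ (a ℤ.+ a)) ℤ.+ g (x ℤ.- (a ℤ.+ a)))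
act² α β a g x
  rewrite ℤ.+-assoc x a a | minus-minus-+ x a | plus-minus x a | minus-plus-cancel x a =
  collect α β (g x) (g (x ℤ.+ a)) (g (x ℤ.- a)) (g (x ℤ.+ (a ℤ.+ a))) (g (x ℤ.- (a ℤ.+ a)))
  where
  collect : ∀ α β p q r u v →
    α ℤ.* (α ℤ.* p ℤ.+ β ℤ.* (q ℤ.+ r))
      ℤ.+ β ℤ.* ((α ℤ.* q ℤ.+ β ℤ.* (u ℤ.+ p)) ℤ.+ (α ℤ.* r ℤ.+ β ℤ.* (p ℤ.+ v))) ≡
    (α ℤ.* α ℤ.+ (β ℤ.* β ℤ.+ β ℤ.* β)) ℤ.* p
      ℤ.+ (α ℤ.* β ℤ.+ α ℤ.* β) ℤ.* (q ℤ.+ r) ℤ.+ β ℤ.* β ℤ.* (u ℤ.+ v)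
  collect = solve-∀

-- With T = zᵃ + z⁻ᵃ, in (2 + T)²(P + t) + (2 - T)²(P - t) the terms in TP, t and T²t cancel. There
-- remains 2((4 + T²)P + 4Tt), where 4 + T² = 6 + z²ᵃ + z⁻²ᵃ.
positiveDefinite-step : ∀ a (P t : ℤ → ℤ) →
  PositiveDefinite (λ x → P x ℤ.+ t x) → PositiveDefinite (λ x → P x ℤ.- t x) →
  PositiveDefinite (λ x →
    (+ 6 ℤ.* P x ℤ.+ (P (x ℤ.+ (a ℤ.+ a)) ℤ.+ P (x ℤ.- (a ℤ.+ a))))
      ℤ.+ + 4 ℤ.* (t (x ℤ.+ a) ℤ.+ t (x ℤ.- a)))
positiveDefinite-step a P t pd₊ pd₋ =
  positiveDefinite-halve (positiveDefinite-cong expand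
    (positiveDefinite-+ (positiveDefinite-act² (+ 2) 1ℤ a pd₊)
                        (positiveDefinite-act² (+ 2) ℤ.-1ℤ a pd₋)))
  where
  collect : ∀ p s p₁ p₂ s₁ s₂ p₃ p₄ s₃ s₄ →
    (+ 6 ℤ.* (p ℤ.+ s) ℤ.+ + 4 ℤ.* ((p₁ ℤ.+ s₁) ℤ.+ (p₂ ℤ.+ s₂))
      ℤ.+ 1ℤ ℤ.* ((p₃ ℤ.+ s₃) ℤ.+ (p₄ ℤ.+ s₄)))
    ℤ.+ (+ 6 ℤ.* (p ℤ.- s) ℤ.+ ℤ.- (+ 4) ℤ.* ((p₁ ℤ.- s₁) ℤ.+ (p₂ ℤ.- s₂))
      ℤ.+ 1ℤ ℤ.* ((p₃ ℤ.- s₃) ℤ.+ (p₄ ℤ.- s₄))) ≡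
    ((+ 6 ℤ.* p ℤ.+ (p₃ ℤ.+ p₄)) ℤ.+ + 4 ℤ.* (s₁ ℤ.+ s₂))
      ℤ.+ ((+ 6 ℤ.* p ℤ.+ (p₃ ℤ.+ p₄)) ℤ.+ + 4 ℤ.* (s₁ ℤ.+ s₂))
  collect = solve-∀
  expand : _ ≗ᶻ _
  expand x = trans
    (cong₂ ℤ._+_ (act² (+ 2) 1ℤ a (λ x → P x ℤ.+ t x) x) (act² (+ 2) ℤ.-1ℤ a (λ x → P x ℤ.- t x) x))
    (collect (P x) (t x) (P (x ℤ.+ a)) (P (x ℤ.- a)) (t (x ℤ.+ a)) (t (x ℤ.- a))
      (P (x ℤ.+ (a ℤ.+ a))) (P (x ℤ.- (a ℤ.+ a))) (t (x ℤ.+ (a ℤ.+ a))) (t (x ℤ.- (a ℤ.+ a))))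

positiveDefinite-0 : PositiveDefinite (λ _ → 0ℤ)
positiveDefinite-0 = positiveDefinite-act² 0ℤ 0ℤ 0ℤ positiveDefinite-δ

-- The form at 1 + σzˣ. For σ = ±1 this is the classical test comparing a positive definite function
-- with its value at 0.
two-point : ∀ {g} → PositiveDefinite g → ∀ σ x →
  0ℤ ℤ.≤ (1ℤ ℤ.+ σ ℤ.* σ) ℤ.* g 0ℤ ℤ.+ σ ℤ.* (g x ℤ.+ g (ℤ.- x))
two-point {g} pd σ x = subst (0ℤ ℤ.≤_) eq (pd .PositiveDefinite.form≥0 ((1ℤ , 0ℤ) ∷ (σ , x) ∷ []))
  where
  collect : ∀ σ o p q →
    1ℤ ℤ.* (1ℤ ℤ.* o ℤ.+ (σ ℤ.* q ℤ.+ 0ℤ)) ℤ.+ (σ ℤ.* (1ℤ ℤ.* p ℤ.+ (σ ℤ.* o ℤ.+ 0ℤ)) ℤ.+ 0ℤ)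
    ≡ (1ℤ ℤ.+ σ ℤ.* σ) ℤ.* o ℤ.+ σ ℤ.* (p ℤ.+ q)
  collect = solve-∀
  eq : form g ((1ℤ , 0ℤ) ∷ (σ , x) ∷ []) ((1ℤ , 0ℤ) ∷ (σ , x) ∷ []) ≡ _
  eq rewrite ℤ.+-inverseʳ x | ℤ.+-identityʳ x | ℤ.+-identityˡ (ℤ.- x) =
    collect σ (g 0ℤ) (g x) (g (ℤ.- x))

module _ (P t : ℤ → ℤ) (pd₊ : PositiveDefinite (λ x → P x ℤ.+ t x))
         (pd₋ : PositiveDefinite (λ x → P x ℤ.- t x)) where

  -- Adding the test of P - t with σ = 1 to that of P + t with σ = -1 cancels t at 0 and P at ±x. By
  -- evenness of t there remains 4(P 0 - t x).
  minorant≤ : (∀ x → t (ℤ.- x) ≡ t x) → ∀ x → t x ℤ.≤ P 0ℤ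
  minorant≤ even x = ℤ.0≤i-j⇒j≤i (ℤ.*-cancelˡ-≤-pos 0ℤ _ (+ 4) (subst (0ℤ ℤ.≤_) eq
    (ℤ.+-mono-≤ (two-point pd₋ 1ℤ x) (two-point pd₊ ℤ.-1ℤ x))))
    where
    collect : ∀ o s p q u →
      (+ 2 ℤ.* (o ℤ.- s) ℤ.+ 1ℤ ℤ.* ((p ℤ.- u) ℤ.+ (q ℤ.- u)))
      ℤ.+ (+ 2 ℤ.* (o ℤ.+ s) ℤ.+ ℤ.-1ℤ ℤ.* ((p ℤ.+ u) ℤ.+ (q ℤ.+ u)))
      ≡ + 4 ℤ.* (o ℤ.- u)
    collect = solve-∀
    eq = trans
      (cong (λ u → (+ 2 ℤ.* (P 0ℤ ℤ.- t 0ℤ) ℤ.+ 1ℤ ℤ.* ((P x ℤ.- t x) ℤ.+ (P (ℤ.- x) ℤ.- u)))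
        ℤ.+ (+ 2 ℤ.* (P 0ℤ ℤ.+ t 0ℤ) ℤ.+ ℤ.-1ℤ ℤ.* ((P x ℤ.+ t x) ℤ.+ (P (ℤ.- x) ℤ.+ u))))
        (even x))
      (collect (P 0ℤ) (t 0ℤ) (P x) (P (ℤ.- x)) (t x))

  -- With σ = -1 in both tests every value of t cancels: in effect P, as half the sum of P + t and P
  -- - t, is tested alone.
  majorant≤ : (∀ x → P (ℤ.- x) ≡ P x) → ∀ x → P x ℤ.≤ P 0ℤ
  majorant≤ even x = ℤ.0≤i-j⇒j≤i (ℤ.*-cancelˡ-≤-pos 0ℤ _ (+ 4) (subst (0ℤ ℤ.≤_) eq
    (ℤ.+-mono-≤ (two-point pd₋ ℤ.-1ℤ x) (two-point pd₊ ℤ.-1ℤ x))))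
    where
    collect : ∀ o s p u v →
      (+ 2 ℤ.* (o ℤ.- s) ℤ.+ ℤ.-1ℤ ℤ.* ((p ℤ.- u) ℤ.+ (p ℤ.- v)))
      ℤ.+ (+ 2 ℤ.* (o ℤ.+ s) ℤ.+ ℤ.-1ℤ ℤ.* ((p ℤ.+ u) ℤ.+ (p ℤ.+ v)))
      ≡ + 4 ℤ.* (o ℤ.- p)
    collect = solve-∀
    eq = trans
      (cong (λ u → (+ 2 ℤ.* (P 0ℤ ℤ.- t 0ℤ) ℤ.+ ℤ.-1ℤ ℤ.* ((P x ℤ.- t x) ℤ.+ (u ℤ.- t (ℤ.- x))))
        ℤ.+ (+ 2 ℤ.* (P 0ℤ ℤ.+ t 0ℤ) ℤ.+ ℤ.-1ℤ ℤ.* ((P x ℤ.+ t x) ℤ.+ (u ℤ.+ t (ℤ.- x)))))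
        (even x))
      (collect (P 0ℤ) (t 0ℤ) (P x) (t x) (t (ℤ.- x)))

-- The lazy walk

-- 8ⁿ times the law of Σ 2 aᵢ ηᵢ, where ηᵢ = 0 with probability 3/4 and ±1 with probability 1/8 each.
lazy : List ℤ → ℤ → ℕ
lazy []      x = δ x
lazy (a ∷ A) x = 6 * lazy A x + (lazy A (x ℤ.+ (a ℤ.+ a)) + lazy A (x ℤ.- (a ℤ.+ a)))

indicator : Bool → ℕ
indicator b = if b then 1 else 0

length-filterᵇ-∷ : ∀ {X : Set} (p : X → Bool) x xs →
  length (filterᵇ p (x ∷ xs)) ≡ indicator (p x) + length (filterᵇ p xs)
length-filterᵇ-∷ p x xs with p x
... | true  = refl
... | false = refl

length-filterᵇ-concatMap : ∀ {X Y : Set} (p : Y → Bool) (f g : X → Y) xs →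
  length (filterᵇ p (concatMap (λ x → f x ∷ g x ∷ []) xs)) ≡
  length (filterᵇ (p ∘ f) xs) + length (filterᵇ (p ∘ g) xs)
length-filterᵇ-concatMap p f g []       = refl
length-filterᵇ-concatMap p f g (x ∷ xs)
  rewrite length-filterᵇ-∷ p (f x) (g x ∷ concatMap (λ x → f x ∷ g x ∷ []) xs)
        | length-filterᵇ-∷ p (g x) (concatMap (λ x → f x ∷ g x ∷ []) xs)
        | length-filterᵇ-∷ (p ∘ f) x xs | length-filterᵇ-∷ (p ∘ g) x xs
        | length-filterᵇ-concatMap p f g xs =
  regroup (indicator (p (f x))) (indicator (p (g x))) (length (filterᵇ (p ∘ f) xs)) _
  where
  regroup : ∀ a b c d → a + (b + (c + d)) ≡ a + c + (b + d)
  regroup = solveℕ-∀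

length-filterᵇ-cong : ∀ {X : Set} {p q : X → Bool} → (∀ x → p x ≡ q x) → ∀ xs →
  length (filterᵇ p xs) ≡ length (filterᵇ q xs)
length-filterᵇ-cong         p≗q []       = refl
length-filterᵇ-cong {p = p} {q} p≗q (x ∷ xs)
  rewrite length-filterᵇ-∷ p x xs | length-filterᵇ-∷ q x xs =
  cong₂ (λ b m → indicator b + m) (p≗q x) (length-filterᵇ-cong p≗q xs)

⌊⌋-⇔ : ∀ {P Q : Set} (p? : Dec P) (q? : Dec Q) → (P → Q) → (Q → P) → ⌊ p? ⌋ ≡ ⌊ q? ⌋
⌊⌋-⇔ (yes p) (yes q) f g = refl
⌊⌋-⇔ (yes p) (no ¬q) f g = contradiction (f p) ¬q
⌊⌋-⇔ (no ¬p) (yes q) f g = contradiction (g q) ¬p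
⌊⌋-⇔ (no ¬p) (no ¬q) f g = refl

atoms-[] : ∀ x → atoms [] x ≡ δ x
atoms-[] x with 0ℤ ℤ.≟ x
... | yes refl = refl
... | no 0≢x   = sym (δ-≢0 (0≢x ∘ sym))

atoms-∷ : ∀ a A x → atoms (a ∷ A) x ≡ atoms A (x ℤ.+ a) + atoms A (x ℤ.- a)
atoms-∷ a A x = begin
  atoms (a ∷ A) x
    ≡⟨ length-filterᵇ-concatMap _ (+ 1 ∷_) (ℤ.-[1+ 0 ] ∷_) (signs (length A)) ⟩
  length (filterᵇ (λ ξ → ⌊ a ℤ.* + 1 ℤ.+ dot A ξ ℤ.≟ x ⌋) (signs (length A))) +
  length (filterᵇ (λ ξ → ⌊ a ℤ.* ℤ.-1ℤ ℤ.+ dot A ξ ℤ.≟ x ⌋) (signs (length A)))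
    ≡⟨ cong₂ _+_
         (length-filterᵇ-cong (λ ξ → ⌊⌋-⇔ _ _ (to₊ (dot A ξ)) (from₊ (dot A ξ))) (signs (length A)))
         (length-filterᵇ-cong (λ ξ → ⌊⌋-⇔ _ _ (to₋ (dot A ξ)) (from₋ (dot A ξ))) (signs (length A))) ⟩
  atoms A (x ℤ.- a) + atoms A (x ℤ.+ a)
    ≡⟨ ℕ.+-comm (atoms A (x ℤ.- a)) _ ⟩
  atoms A (x ℤ.+ a) + atoms A (x ℤ.- a) ∎
  where
  open ≡-Reasoning
  cancel₊ : ∀ a s → a ℤ.* 1ℤ ℤ.+ s ℤ.- a ≡ s
  cancel₊ = solve-∀
  cancel₊′ : ∀ a x → a ℤ.* 1ℤ ℤ.+ (x ℤ.- a) ≡ x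
  cancel₊′ = solve-∀
  cancel₋ : ∀ a s → a ℤ.* ℤ.-1ℤ ℤ.+ s ℤ.+ a ≡ s
  cancel₋ = solve-∀
  cancel₋′ : ∀ a x → a ℤ.* ℤ.-1ℤ ℤ.+ (x ℤ.+ a) ≡ x
  cancel₋′ = solve-∀
  to₊ : ∀ s → a ℤ.* 1ℤ ℤ.+ s ≡ x → s ≡ x ℤ.- a
  to₊ s refl = sym (cancel₊ a s)
  from₊ : ∀ s → s ≡ x ℤ.- a → a ℤ.* 1ℤ ℤ.+ s ≡ x
  from₊ s refl = cancel₊′ a x
  to₋ : ∀ s → a ℤ.* ℤ.-1ℤ ℤ.+ s ≡ x → s ≡ x ℤ.+ a
  to₋ s refl = sym (cancel₋ a s)
  from₋ : ∀ s → s ≡ x ℤ.+ a → a ℤ.* ℤ.-1ℤ ℤ.+ s ≡ x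
  from₋ s refl = cancel₋′ a x

-- The factor 4ⁿ turns counts out of 2ⁿ into counts out of 8ⁿ, the scale of `lazy`.
scaledAtoms : List ℤ → ℤ → ℕ
scaledAtoms A x = 4 ^ length A * atoms A x

scaledAtoms-∷ : ∀ a A x →
  scaledAtoms (a ∷ A) x ≡ 4 * (scaledAtoms A (x ℤ.+ a) + scaledAtoms A (x ℤ.- a))
scaledAtoms-∷ a A x rewrite atoms-∷ a A x =
  collect 4 (4 ^ length A) (atoms A (x ℤ.+ a)) (atoms A (x ℤ.- a))
  where
  collect : ∀ k c p q → k * c * (p + q) ≡ k * (c * p + c * q)
  collect = solveℕ-∀

δ-even : ∀ x → δ (ℤ.- x) ≡ δ x
δ-even (+ 0)        = refl
δ-even ℤ.+[1+ n ]   = refl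
δ-even ℤ.-[1+ n ]   = refl

neg-+ : ∀ x a → ℤ.- x ℤ.+ a ≡ ℤ.- (x ℤ.- a)
neg-+ = solve-∀

neg-- : ∀ x a → ℤ.- x ℤ.- a ≡ ℤ.- (x ℤ.+ a)
neg-- = solve-∀

lazy-even : ∀ A x → lazy A (ℤ.- x) ≡ lazy A x
lazy-even []      x = δ-even x
lazy-even (a ∷ A) x
  rewrite neg-+ x (a ℤ.+ a) | neg-- x (a ℤ.+ a) | lazy-even A x
        | lazy-even A (x ℤ.- (a ℤ.+ a)) | lazy-even A (x ℤ.+ (a ℤ.+ a)) =
  cong (λ u → 6 * lazy A x + u) (ℕ.+-comm (lazy A (x ℤ.- (a ℤ.+ a))) _)

atoms-even : ∀ A x → atoms A (ℤ.- x) ≡ atoms A x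
atoms-even []      x = trans (atoms-[] (ℤ.- x)) (trans (δ-even x) (sym (atoms-[] x)))
atoms-even (a ∷ A) x
  rewrite atoms-∷ a A (ℤ.- x) | atoms-∷ a A x | neg-+ x a | neg-- x a
        | atoms-even A (x ℤ.- a) | atoms-even A (x ℤ.+ a) =
  ℕ.+-comm (atoms A (x ℤ.- a)) _

pos-lazy-∷ : ∀ a A x → + lazy (a ∷ A) x ≡
  + 6 ℤ.* + lazy A x ℤ.+ (+ lazy A (x ℤ.+ (a ℤ.+ a)) ℤ.+ + lazy A (x ℤ.- (a ℤ.+ a)))
pos-lazy-∷ a A x =
  cong (λ u → u ℤ.+ + (lazy A (x ℤ.+ (a ℤ.+ a)) + lazy A (x ℤ.- (a ℤ.+ a)))) (ℤ.pos-* 6 (lazy A x))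

pos-scaledAtoms-∷ : ∀ a A x → + scaledAtoms (a ∷ A) x ≡
  + 4 ℤ.* (+ scaledAtoms A (x ℤ.+ a) ℤ.+ + scaledAtoms A (x ℤ.- a))
pos-scaledAtoms-∷ a A x =
  trans (cong +_ (scaledAtoms-∷ a A x)) (ℤ.pos-* 4 (scaledAtoms A (x ℤ.+ a) + scaledAtoms A (x ℤ.- a)))

-- With T = zᵃ + z⁻ᵃ one has 2(P′ ± t′) = (2 + T)²(P ± t) + (2 - T)²(P ∓ t), where
-- P′ = (6 + z²ᵃ + z⁻²ᵃ)P and t′ = 4Tt: this plays the part of |cos θ| ≤ 3/4 + cos(2θ)/4.
lazy±atoms-positiveDefinite : ∀ A →
  PositiveDefinite (λ x → + lazy A x ℤ.+ + scaledAtoms A x) ×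
  PositiveDefinite (λ x → + lazy A x ℤ.- + scaledAtoms A x)
lazy±atoms-positiveDefinite [] =
  -- For the empty list both functions are δ, so their sum is 2δ and their difference 0.
  positiveDefinite-cong (λ x → cong (λ u → δᶻ x ℤ.+ + u) (base x))
    (positiveDefinite-+ positiveDefinite-δ positiveDefinite-δ) ,
  positiveDefinite-cong (λ x → trans (sym (ℤ.+-inverseʳ (δᶻ x))) (cong (λ u → δᶻ x ℤ.- + u) (base x)))
    positiveDefinite-0
  where
  base : ∀ x → δ x ≡ scaledAtoms [] x
  base x = sym (trans (ℕ.*-identityˡ (atoms [] x)) (atoms-[] x))
lazy±atoms-positiveDefinite (a ∷ A) with lazy±atoms-positiveDefinite A
... | pd₊ , pd₋ =
  positiveDefinite-cong
    (λ x → sym (cong₂ ℤ._+_ (pos-lazy-∷ a A x) (pos-scaledAtoms-∷ a A x)))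
    (positiveDefinite-step a (λ x → + lazy A x) (λ x → + scaledAtoms A x) pd₊ pd₋) ,
  positiveDefinite-cong
    (λ x → trans (cong (λ u → + 6 ℤ.* + lazy A x ℤ.+
                                      (+ lazy A (x ℤ.+ (a ℤ.+ a)) ℤ.+ + lazy A (x ℤ.- (a ℤ.+ a))) ℤ.+ u)
                        (negate (+ scaledAtoms A (x ℤ.+ a)) (+ scaledAtoms A (x ℤ.- a))))
                 (sym (cong₂ ℤ._-_ (pos-lazy-∷ a A x) (pos-scaledAtoms-∷ a A x))))
    -- Replacing t by -t exchanges the two hypotheses and changes the sign of 4Tt.
    (positiveDefinite-step a (λ x → + lazy A x) (λ x → ℤ.- (+ scaledAtoms A x)) pd₋
      (positiveDefinite-cong
        (λ x → cong (λ u → + lazy A x ℤ.+ u) (sym (ℤ.neg-involutive (+ scaledAtoms A x)))) pd₊))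
  where
  negate : ∀ p q → + 4 ℤ.* (ℤ.- p ℤ.+ ℤ.- q) ≡ ℤ.- (+ 4 ℤ.* (p ℤ.+ q))
  negate = solve-∀

-- This is P(Σ aᵢξᵢ = x) ≤ U(A), with both sides multiplied by 8ⁿ.
scaledAtoms≤lazy : ∀ A x → scaledAtoms A x ℕ.≤ lazy A 0ℤ
scaledAtoms≤lazy A x with lazy±atoms-positiveDefinite A
... | pd₊ , pd₋ = ℤ.drop‿+≤+
  (minorant≤ (λ y → + lazy A y) (λ y → + scaledAtoms A y) pd₊ pd₋
    (λ y → cong (λ u → + (4 ^ length A * u)) (atoms-even A y)) x)

lazy≤lazy-0 : ∀ A x → lazy A x ℕ.≤ lazy A 0ℤ
lazy≤lazy-0 A x with lazy±atoms-positiveDefinite A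
... | pd₊ , pd₋ = ℤ.drop‿+≤+
  (majorant≤ (λ y → + lazy A y) (λ y → + scaledAtoms A y) pd₊ pd₋
    (λ y → cong +_ (lazy-even A y)) x)

maxAtom≤lazy : ∀ A → 4 ^ length A * maxAtom A ℕ.≤ lazy A 0ℤ
maxAtom≤lazy A = bound (signs (length A))
  where
  bound : ∀ ξs → 4 ^ length A * foldr _⊔_ 0 (map (λ ξ → atoms A (dot A ξ)) ξs) ℕ.≤ lazy A 0ℤ
  bound []       = subst (ℕ._≤ lazy A 0ℤ) (sym (ℕ.*-zeroʳ (4 ^ length A))) z≤n
  bound (ξ ∷ ξs) =
    subst (ℕ._≤ lazy A 0ℤ) (sym (ℕ.*-distribˡ-⊔ (4 ^ length A) (atoms A (dot A ξ)) _))
      (ℕ.⊔-lub (scaledAtoms≤lazy A (dot A ξ)) (bound ξs))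

-- Finite sums and the total mass of the lazy walk

sum-map-+ : ∀ {X : Set} (f g : X → ℕ) xs →
  sum (map (λ x → f x + g x) xs) ≡ sum (map f xs) + sum (map g xs)
sum-map-+ f g []       = refl
sum-map-+ f g (x ∷ xs) rewrite sum-map-+ f g xs = regroup (f x) (g x) (sum (map f xs)) _
  where
  regroup : ∀ p q u v → p + q + (u + v) ≡ p + u + (q + v)
  regroup = solveℕ-∀

sum-map-* : ∀ {X : Set} c (f : X → ℕ) xs → sum (map (λ x → c * f x) xs) ≡ c * sum (map f xs)
sum-map-* c f []       = sym (ℕ.*-zeroʳ c)
sum-map-* c f (x ∷ xs) rewrite sum-map-* c f xs = sym (ℕ.*-distribˡ-+ c (f x) _)

sum-map-mono : ∀ {X : Set} {f g : X → ℕ} → (∀ x → f x ℕ.≤ g x) → ∀ xs →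
  sum (map f xs) ℕ.≤ sum (map g xs)
sum-map-mono f≤g []       = z≤n
sum-map-mono f≤g (x ∷ xs) = ℕ.+-mono-≤ (f≤g x) (sum-map-mono f≤g xs)

sum-map-const : ∀ {X : Set} c (xs : List X) → sum (map (λ _ → c) xs) ≡ length xs * c
sum-map-const c []       = refl
sum-map-const c (x ∷ xs) = cong (λ u → c + u) (sum-map-const c xs)

sum-δ≡0 : ∀ {ws} → All (0ℤ ≢_) ws → sum (map δ ws) ≡ 0
sum-δ≡0 []         = refl
sum-δ≡0 (0≢w ∷ ws) = cong₂ _+_ (δ-≢0 (0≢w ∘ sym)) (sum-δ≡0 ws)

sum-δ≤1 : ∀ {ws} → Unique ws → sum (map δ ws) ℕ.≤ 1
sum-δ≤1 [] = z≤n
sum-δ≤1 {w ∷ ws} (w∉ws ∷ uniq) with w ℤ.≟ 0ℤ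
... | yes refl = ℕ.≤-reflexive (cong suc (sum-δ≡0 w∉ws))
... | no _     = sum-δ≤1 uniq

-- The law has total mass 8ⁿ. The induction works for any list of distinct points because
-- translating by ±2a keeps them distinct, and 6 + 1 + 1 = 8.
sum-lazy≤ : ∀ A {ws} → Unique ws → sum (map (lazy A) ws) ℕ.≤ 8 ^ length A
sum-lazy≤ []      uniq = sum-δ≤1 uniq
sum-lazy≤ (a ∷ A) {ws} uniq = begin
  sum (map (lazy (a ∷ A)) ws)
    ≡⟨ sum-map-+ (λ x → 6 * lazy A x) _ ws ⟩
  sum (map (λ x → 6 * lazy A x) ws) +
    sum (map (λ x → lazy A (x ℤ.+ 2a) + lazy A (x ℤ.- 2a)) ws)
    ≡⟨ cong₂ _+_ (sum-map-* 6 (lazy A) ws) (sum-map-+ (λ x → lazy A (x ℤ.+ 2a)) _ ws) ⟩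
  6 * sum (map (lazy A) ws) +
    (sum (map (λ x → lazy A (x ℤ.+ 2a)) ws) + sum (map (λ x → lazy A (x ℤ.- 2a)) ws))
    ≡⟨ cong₂ (λ u v → 6 * sum (map (lazy A) ws) + (sum u + sum v)) (map-∘ ws) (map-∘ ws) ⟩
  6 * sum (map (lazy A) ws) +
    (sum (map (lazy A) (map (ℤ._+ 2a) ws)) + sum (map (lazy A) (map (ℤ._- 2a) ws)))
    ≤⟨ ℕ.+-mono-≤ (ℕ.*-monoʳ-≤ 6 (sum-lazy≤ A uniq))
         (ℕ.+-mono-≤ (sum-lazy≤ A (map⁺ (+-cancelʳ 2a _ _) uniq))
                     (sum-lazy≤ A (map⁺ (+-cancelʳ (ℤ.- 2a) _ _) uniq))) ⟩
  6 * 8 ^ length A + (8 ^ length A + 8 ^ length A)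
    ≡⟨ collect (8 ^ length A) ⟩
  8 * 8 ^ length A ∎
  where
  open ℕ.≤-Reasoning
  2a = a ℤ.+ a
  collect : ∀ c → 6 * c + (c + c) ≡ 8 * c
  collect = solveℕ-∀

lazy-0≤ : ∀ A → lazy A 0ℤ ℕ.≤ 8 ^ length A
lazy-0≤ A = subst (ℕ._≤ 8 ^ length A) (ℕ.+-identityʳ (lazy A 0ℤ)) (sum-lazy≤ A {0ℤ ∷ []} ([] ∷ []))

-- Evenness merges the contributions of 2a and -2a. Divided by 8ⁿ⁺¹, with n the length of `A`, this
-- is the recursion U(a ∷ A) = (3/4) U(A) + (1/4) P(Σ 2aᵢηᵢ = 2a).
lazy-∷-0 : ∀ a A → lazy (a ∷ A) 0ℤ ≡ 6 * lazy A 0ℤ + 2 * lazy A (a ℤ.+ a)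
lazy-∷-0 a A
  rewrite ℤ.+-identityˡ (a ℤ.+ a) | ℤ.+-identityˡ (ℤ.- (a ℤ.+ a)) | lazy-even A (a ℤ.+ a) =
  cong (λ u → 6 * lazy A 0ℤ + u) (double (lazy A (a ℤ.+ a)))
  where
  double : ∀ c → c + c ≡ 2 * c
  double = solveℕ-∀

-- Moments over all sequences

sum-swap : ∀ {X Y : Set} (f : X → Y → ℕ) xs ys →
  sum (map (λ x → sum (map (f x) ys)) xs) ≡ sum (map (λ y → sum (map (λ x → f x y) xs)) ys)
sum-swap f []       ys = sym (trans (sum-map-const 0 ys) (ℕ.*-zeroʳ (length ys)))
sum-swap f (x ∷ xs) ys = trans (cong (λ u → sum (map (f x) ys) + u) (sum-swap f xs ys))
  (sym (sum-map-+ (f x) (λ y → sum (map (λ x → f x y) xs)) ys))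

-- In a sequence the first entry ranges over all of `vs` whatever the rest is, so sums over it can
-- be exchanged with sums over the tail; ordered representatives of multisets lack this
-- independence.
seqSum : List ℤ → ℕ → (List ℤ → ℕ) → ℕ
seqSum vs zero    f = f []
seqSum vs (suc n) f = sum (map (λ v → seqSum vs n (f ∘ (v ∷_))) vs)

seqSum-mono : ∀ vs n {f g} → (∀ A → length A ≡ n → f A ℕ.≤ g A) → seqSum vs n f ℕ.≤ seqSum vs n g
seqSum-mono vs zero    f≤g = f≤g [] refl
seqSum-mono vs (suc n) f≤g =
  sum-map-mono (λ v → seqSum-mono vs n (λ A len → f≤g (v ∷ A) (cong suc len))) vs

seqSum-* : ∀ vs n c f → seqSum vs n (λ A → c * f A) ≡ c * seqSum vs n f
seqSum-* vs zero    c f = refl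
seqSum-* vs (suc n) c f =
  trans (cong sum (map-cong (λ v → seqSum-* vs n c (f ∘ (v ∷_))) vs)) (sum-map-* c _ vs)

-- Brings the sum over the first entry inside, where it can be estimated for a fixed tail `A`.
seqSum-swap : ∀ vs n ws (g : ℤ → List ℤ → ℕ) →
  sum (map (λ w → seqSum vs n (g w)) ws) ≡ seqSum vs n (λ A → sum (map (λ w → g w A) ws))
seqSum-swap vs zero    ws g = refl
seqSum-swap vs (suc n) ws g =
  trans (sum-swap (λ w v → seqSum vs n (g w ∘ (v ∷_))) ws vs)
        (cong sum (map-cong (λ v → seqSum-swap vs n ws (λ w → g w ∘ (v ∷_))) vs))

seqSum-∷ : ∀ v vs n f → seqSum vs n f ℕ.≤ seqSum (v ∷ vs) n f
seqSum-∷ v vs zero    f = ℕ.≤-refl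
seqSum-∷ v vs (suc n) f =
  ℕ.≤-trans (sum-map-mono (λ w → seqSum-∷ v vs n (f ∘ (w ∷_))) vs)
            (ℕ.m≤n+m _ (seqSum (v ∷ vs) n (f ∘ (v ∷_))))

-- Each multiset is listed once, as one particular sequence, and the terms are natural numbers.
-- Lists that avoid `v` are counted among those whose later entries may also be `v`.
sum-multisets≤seqSum : ∀ vs n f → sum (map f (multisets vs n)) ℕ.≤ seqSum vs n f
sum-multisets≤seqSum vs       zero    f = ℕ.≤-reflexive (ℕ.+-identityʳ (f []))
sum-multisets≤seqSum []       (suc n) f = z≤n
sum-multisets≤seqSum (v ∷ vs) (suc n) f = begin
  sum (map f (map (v ∷_) (multisets (v ∷ vs) n) ++ multisets vs (suc n)))
    ≡⟨ cong sum (map-++ f (map (v ∷_) (multisets (v ∷ vs) n)) _) ⟩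
  sum (map f (map (v ∷_) (multisets (v ∷ vs) n)) ++ map f (multisets vs (suc n)))
    ≡⟨ sum-++ (map f (map (v ∷_) (multisets (v ∷ vs) n))) _ ⟩
  sum (map f (map (v ∷_) (multisets (v ∷ vs) n))) + sum (map f (multisets vs (suc n)))
    ≡⟨ cong (λ u → sum u + sum (map f (multisets vs (suc n)))) (map-∘ (multisets (v ∷ vs) n)) ⟨
  sum (map (f ∘ (v ∷_)) (multisets (v ∷ vs) n)) + sum (map f (multisets vs (suc n)))
    ≤⟨ ℕ.+-mono-≤ (sum-multisets≤seqSum (v ∷ vs) n (f ∘ (v ∷_))) (sum-multisets≤seqSum vs (suc n) f) ⟩
  seqSum (v ∷ vs) n (f ∘ (v ∷_)) + seqSum vs (suc n) f
    ≤⟨ ℕ.+-monoʳ-≤ (seqSum (v ∷ vs) n (f ∘ (v ∷_)))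
         (sum-map-mono (λ w → seqSum-∷ v vs n (f ∘ (w ∷_))) vs) ⟩
  seqSum (v ∷ vs) (suc n) f ∎
  where open ℕ.≤-Reasoning

-- Convexity of x ↦ xᵏ⁺¹ on [6, 8], at the weighted mean (8V + 6W)/(V + W).
power-convex : ∀ k V W →
  (8 * V + 6 * W) ^ suc k ℕ.≤ (V + W) ^ k * (8 ^ suc k * V + 6 ^ suc k * W)
power-convex zero    V W = ℕ.≤-reflexive (trans (ℕ.*-identityʳ _) (sym (ℕ.*-identityˡ _)))
power-convex (suc k) V W = begin
  (8 * V + 6 * W) * (8 * V + 6 * W) ^ suc k
    ≤⟨ ℕ.*-monoʳ-≤ (8 * V + 6 * W) (power-convex k V W) ⟩
  (8 * V + 6 * W) * ((V + W) ^ k * (a * V + b * W))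
    ≡⟨ swap (8 * V + 6 * W) ((V + W) ^ k) (a * V + b * W) ⟩
  (V + W) ^ k * ((8 * V + 6 * W) * (a * V + b * W))
    ≤⟨ ℕ.*-monoʳ-≤ ((V + W) ^ k) chebyshev ⟩
  (V + W) ^ k * ((V + W) * (8 * a * V + 6 * b * W))
    ≡⟨ swap′ ((V + W) ^ k) (V + W) (8 * a * V + 6 * b * W) ⟩
  (V + W) * (V + W) ^ k * (8 * a * V + 6 * b * W) ∎
  where
  open ℕ.≤-Reasoning
  a = 8 ^ suc k
  b = 6 ^ suc k
  e = a ∸ b
  swap : ∀ x y z → x * (y * z) ≡ y * (x * z)
  swap = solveℕ-∀
  swap′ : ∀ x y z → x * (y * z) ≡ y * x * z
  swap′ = solveℕ-∀
  identity : ∀ b e V W → (8 * V + 6 * W) * ((b + e) * V + b * W) + 2 * (e * (V * W)) ≡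
    (V + W) * (8 * (b + e) * V + 6 * b * W)
  identity = solveℕ-∀
  b≤a : b ℕ.≤ a
  b≤a = ℕ.^-monoˡ-≤ (suc k) (ℕ.m≤m+n 6 2)
  -- Chebyshev's sum inequality for the pairs (8, 6) and (a, b), ordered alike, with weights V and
  -- W. Writing a = b + e makes the slack 2eVW visibly nonnegative.
  chebyshev : (8 * V + 6 * W) * (a * V + b * W) ℕ.≤ (V + W) * (8 * a * V + 6 * b * W)
  chebyshev = subst (λ x → (8 * V + 6 * W) * (x * V + b * W) ℕ.≤ (V + W) * (8 * x * V + 6 * b * W))
    (ℕ.m+[n∸m]≡n b≤a) (ℕ.m+n≤o⇒m≤o _ (ℕ.≤-reflexive (identity b e V W)))

double-injective : ∀ {a b : ℤ} → a ℤ.+ a ≡ b ℤ.+ b → a ≡ b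
double-injective {a} {b} eq = ℤ.*-cancelˡ-≡ (+ 2) a b
  (trans (double a) (trans eq (sym (double b))))
  where
  double : ∀ a → + 2 ℤ.* a ≡ a ℤ.+ a
  double = solve-∀

-- Splitting U = V + W gives 6U + 2V = 8V + 6W, so `power-convex` applies; the truncated difference
-- W is genuine because the law is maximal at 0. The weight V + W is U again, so a k-th power of U
-- factors out. Finally W is enlarged to U.
lazy-∷-power≤ : ∀ k a A → lazy (a ∷ A) 0ℤ ^ suc k ℕ.≤
  lazy A 0ℤ ^ k * (8 ^ suc k * lazy A (a ℤ.+ a) + 6 ^ suc k * lazy A 0ℤ)
lazy-∷-power≤ k a A = begin
  lazy (a ∷ A) 0ℤ ^ suc k
    ≡⟨ cong (_^ suc k) (trans (lazy-∷-0 a A)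
         (trans (cong (λ u → 6 * u + 2 * V) (sym U≡V+W)) (collect V W))) ⟩
  (8 * V + 6 * W) ^ suc k
    ≤⟨ power-convex k V W ⟩
  (V + W) ^ k * (8 ^ suc k * V + 6 ^ suc k * W)
    ≡⟨ cong (λ u → u ^ k * (8 ^ suc k * V + 6 ^ suc k * W)) U≡V+W ⟩
  U ^ k * (8 ^ suc k * V + 6 ^ suc k * W)
    ≤⟨ ℕ.*-monoʳ-≤ (U ^ k) (ℕ.+-monoʳ-≤ (8 ^ suc k * V) (ℕ.*-monoʳ-≤ (6 ^ suc k) (ℕ.m∸n≤m U V))) ⟩
  U ^ k * (8 ^ suc k * V + 6 ^ suc k * U) ∎
  where
  open ℕ.≤-Reasoning
  U = lazy A 0ℤ
  V = lazy A (a ℤ.+ a)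
  W = U ∸ V
  U≡V+W : V + W ≡ U
  U≡V+W = ℕ.m+[n∸m]≡n (lazy≤lazy-0 A (a ℤ.+ a))
  collect : ∀ V W → 6 * (V + W) + 2 * V ≡ 8 * V + 6 * W
  collect = solveℕ-∀

-- The points 2a are distinct, so the values V sum to at most 8 to the length of `A`. The constant
-- terms are controlled by the bound on the number of values together with `lazy-0≤`. The two
-- contributions have the same bound, whence the factor 2.
sum-lazy-∷-power≤ : ∀ {vs} → Unique vs → ∀ k → length vs * 6 ^ suc k ℕ.≤ 8 ^ suc k → ∀ A →
  sum (map (λ a → lazy (a ∷ A) 0ℤ ^ suc k) vs) ℕ.≤ 2 * 8 ^ length A * 8 ^ suc k * lazy A 0ℤ ^ k
sum-lazy-∷-power≤ {vs} uniq k few A = begin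
  sum (map (λ a → lazy (a ∷ A) 0ℤ ^ suc k) vs)
    ≤⟨ sum-map-mono (λ a → lazy-∷-power≤ k a A) vs ⟩
  sum (map (λ a → U ^ k * (8 ^ suc k * V a + 6 ^ suc k * U)) vs)
    ≡⟨ sum-map-* (U ^ k) _ vs ⟩
  U ^ k * sum (map (λ a → 8 ^ suc k * V a + 6 ^ suc k * U) vs)
    ≡⟨ cong (λ u → U ^ k * u) (trans (sum-map-+ (λ a → 8 ^ suc k * V a) _ vs)
         (cong₂ _+_ (sum-map-* (8 ^ suc k) V vs) (sum-map-const (6 ^ suc k * U) vs))) ⟩
  U ^ k * (8 ^ suc k * sum (map V vs) + length vs * (6 ^ suc k * U))
    ≡⟨ cong₂ (λ u v → U ^ k * (8 ^ suc k * sum u + v)) (map-∘ vs)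
         (sym (ℕ.*-assoc (length vs) (6 ^ suc k) U)) ⟩
  U ^ k * (8 ^ suc k * sum (map (lazy A) (map (λ a → a ℤ.+ a) vs)) + length vs * 6 ^ suc k * U)
    ≤⟨ ℕ.*-monoʳ-≤ (U ^ k) (ℕ.+-mono-≤
         (ℕ.*-monoʳ-≤ (8 ^ suc k) (sum-lazy≤ A (map⁺ double-injective uniq)))
         (ℕ.*-mono-≤ few (lazy-0≤ A))) ⟩
  U ^ k * (8 ^ suc k * 8 ^ length A + 8 ^ suc k * 8 ^ length A)
    ≡⟨ collect (U ^ k) (8 ^ suc k) (8 ^ length A) ⟩
  2 * 8 ^ length A * 8 ^ suc k * U ^ k ∎
  where
  open ℕ.≤-Reasoning
  U = lazy A 0ℤ
  V : ℤ → ℕ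
  V a = lazy A (a ℤ.+ a)
  collect : ∀ u p q → u * (p * q + p * q) ≡ 2 * q * p * u
  collect = solveℕ-∀

few-values : ∀ m k → m * 6 ^ k ℕ.≤ 8 ^ k → ∀ i → m * 6 ^ (i + k) ℕ.≤ 8 ^ (i + k)
few-values m k few zero    = few
few-values m k few (suc i) = begin
  m * (6 * 6 ^ (i + k)) ≡⟨ swap m 6 (6 ^ (i + k)) ⟩
  6 * (m * 6 ^ (i + k)) ≤⟨ ℕ.*-mono-≤ (ℕ.m≤m+n 6 2) (few-values m k few i) ⟩
  8 * 8 ^ (i + k)       ∎
  where
  open ℕ.≤-Reasoning
  swap : ∀ x y z → x * (y * z) ≡ y * (x * z)
  swap = solveℕ-∀

-- Removing one entry lowers the exponent by one and costs a factor 2, so the exponent runs from n +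
-- k down to k at the empty sequence, where `lazy` is 1 at 0. The powers of 8 add up because n + n(n
-- + k) = n(n + k + 1).
seqSum-lazy-power≤ : ∀ {vs} → Unique vs → ∀ k → length vs * 6 ^ k ℕ.≤ 8 ^ k → ∀ n →
  seqSum vs n (λ A → lazy A 0ℤ ^ (n + k)) ℕ.≤ 2 ^ n * 8 ^ (n * (n + k))
seqSum-lazy-power≤      uniq k few zero    = ℕ.≤-reflexive (ℕ.^-zeroˡ k)
seqSum-lazy-power≤ {vs} uniq k few (suc n) = begin
  seqSum vs (suc n) (λ A → lazy A 0ℤ ^ suc (n + k))
    ≡⟨ seqSum-swap vs n vs (λ a A → lazy (a ∷ A) 0ℤ ^ suc (n + k)) ⟩
  seqSum vs n (λ A → sum (map (λ a → lazy (a ∷ A) 0ℤ ^ suc (n + k)) vs))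
    ≤⟨ seqSum-mono vs n step ⟩
  seqSum vs n (λ A → 2 * 8 ^ n * 8 ^ suc (n + k) * lazy A 0ℤ ^ (n + k))
    ≡⟨ seqSum-* vs n (2 * 8 ^ n * 8 ^ suc (n + k)) _ ⟩
  2 * 8 ^ n * 8 ^ suc (n + k) * seqSum vs n (λ A → lazy A 0ℤ ^ (n + k))
    ≤⟨ ℕ.*-monoʳ-≤ (2 * 8 ^ n * 8 ^ suc (n + k)) (seqSum-lazy-power≤ uniq k few n) ⟩
  2 * 8 ^ n * 8 ^ suc (n + k) * (2 ^ n * 8 ^ (n * (n + k)))
    ≡⟨ collect (8 ^ n) (8 ^ suc (n + k)) (2 ^ n) (8 ^ (n * (n + k))) ⟩
  2 ^ suc n * (8 ^ suc (n + k) * (8 ^ n * 8 ^ (n * (n + k))))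
    ≡⟨ cong (λ u → 2 ^ suc n * (8 ^ suc (n + k) * u)) (ℕ.^-distribˡ-+-* 8 n (n * (n + k))) ⟨
  2 ^ suc n * (8 ^ suc (n + k) * 8 ^ (n + n * (n + k)))
    ≡⟨ cong (λ u → 2 ^ suc n * (8 ^ suc (n + k) * 8 ^ u)) (ℕ.*-suc n (n + k)) ⟨
  2 ^ suc n * (8 ^ suc (n + k) * 8 ^ (n * suc (n + k)))
    ≡⟨ cong (λ u → 2 ^ suc n * u) (ℕ.^-distribˡ-+-* 8 (suc (n + k)) (n * suc (n + k))) ⟨
  2 ^ suc n * 8 ^ (suc n * (suc n + k)) ∎
  where
  open ℕ.≤-Reasoning
  step : ∀ A → length A ≡ n → sum (map (λ a → lazy (a ∷ A) 0ℤ ^ suc (n + k)) vs) ℕ.≤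
    2 * 8 ^ n * 8 ^ suc (n + k) * lazy A 0ℤ ^ (n + k)
  -- The condition on the number of values is needed at exponent n + 1 + k; it persists from k
  -- upwards because 6 ≤ 8.
  step A refl = sum-lazy-∷-power≤ uniq (n + k) (few-values (length vs) k few (suc n)) A
  collect : ∀ p q t u → 2 * p * q * (t * u) ≡ 2 * t * (q * (p * u))
  collect = solveℕ-∀

-- Choice of the additional exponent `k`

range-unique : ∀ B → Unique (range B)
range-unique B = map⁺ (λ eq → ℤ.+-injective (+-cancelʳ (ℤ.- (+ B)) _ _ eq)) (upTo⁺ _)

length-range : ∀ B → length (range B) ≡ suc (B + B)
length-range B = trans (length-map _ (upTo (suc (B + B)))) (length-upTo (suc (B + B)))

-- With ℓ of order log n, this bounds (log n)² linearly in n, which makes n^(ck) only exponential in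
-- n.
square≤ : ∀ ℓ → ℓ * ℓ ℕ.≤ 2 * 2 ^ ℓ
square≤ 0 = z≤n
square≤ 1 = ℕ.m≤m+n 1 3
square≤ 2 = ℕ.m≤m+n 4 4
square≤ 3 = ℕ.m≤m+n 9 7
-- From ℓ = 3 on, (ℓ + 1)² ≤ 2ℓ², with slack i² + 4i + 2 for ℓ = 3 + i. This fails at ℓ = 2, hence
-- the separate cases up to 3.
square≤ (suc ℓ@(suc (suc (suc i)))) = begin
  suc ℓ * suc ℓ                             ≤⟨ ℕ.m≤m+n _ (i * i + 4 * i + 2) ⟩
  suc ℓ * suc ℓ + (i * i + 4 * i + 2)       ≡⟨ identity i ⟩
  2 * (ℓ * ℓ)                               ≤⟨ ℕ.*-monoʳ-≤ 2 (square≤ ℓ) ⟩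
  2 * (2 * 2 ^ ℓ)                           ∎
  where
  open ℕ.≤-Reasoning
  identity : ∀ i → (4 + i) * (4 + i) + (i * i + 4 * i + 2) ≡ 2 * ((3 + i) * (3 + i))
  identity = solveℕ-∀

binary-bound : ∀ n → n ≥ 1 → Σ ℕ λ ℓ → n ℕ.≤ 2 ^ ℓ × 2 ^ ℓ ℕ.≤ 2 * n
binary-bound 1 _ = 0 , ℕ.≤-refl , ℕ.m≤m+n 1 1
binary-bound (suc n@(suc _)) _ with binary-bound n (s≤s z≤n)
... | ℓ , n≤2^ℓ , 2^ℓ≤2n with suc n ℕ.≤? 2 ^ ℓ
...   | yes n<2^ℓ = ℓ , n<2^ℓ , ℕ.≤-trans 2^ℓ≤2n (ℕ.*-monoʳ-≤ 2 (ℕ.n≤1+n n))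
...   | no  n≮2^ℓ = suc ℓ ,
  (begin
    suc n      ≤⟨ ℕ.+-monoˡ-≤ n (s≤s z≤n) ⟩
    n + n      ≡⟨ cong (λ u → n + u) (ℕ.+-identityʳ n) ⟨
    2 * n      ≤⟨ ℕ.*-monoʳ-≤ 2 n≤2^ℓ ⟩
    2 * 2 ^ ℓ  ∎) ,
  ℕ.*-monoʳ-≤ 2 (ℕ.≤-trans (ℕ.≮⇒≥ n≮2^ℓ) (ℕ.n≤1+n n))
  where open ℕ.≤-Reasoning

^-distrib-* : ∀ x y n → (x * y) ^ n ≡ x ^ n * y ^ n
^-distrib-* x y zero    = refl
^-distrib-* x y (suc n) =
  trans (cong (λ u → x * y * u) (^-distrib-* x y n)) (ℕ.[m*n]*[o*p]≡[m*o]*[n*p] x y (x ^ n) (y ^ n))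

-- Three factors 3/4 bring a quantity below half: 2 · 6³ = 432 ≤ 512 = 8³.
2^j*6^3j≤8^3j : ∀ j → 2 ^ j * 6 ^ (3 * j) ℕ.≤ 8 ^ (3 * j)
2^j*6^3j≤8^3j j = begin
  2 ^ j * 6 ^ (3 * j)  ≡⟨ cong (λ u → 2 ^ j * u) (ℕ.^-*-assoc 6 3 j) ⟨
  2 ^ j * 216 ^ j      ≡⟨ ^-distrib-* 2 216 j ⟨
  432 ^ j              ≤⟨ ℕ.^-monoˡ-≤ j (ℕ.m≤m+n 432 80) ⟩
  512 ^ j              ≡⟨ ℕ.^-*-assoc 8 3 j ⟩
  8 ^ (3 * j)          ∎
  where open ℕ.≤-Reasoning

-- For k = 3(2 + ℓs) and n ≤ 2^ℓ, n^(ck) is at most 2 to the power 6cℓ + 3csℓ². The bounds ℓ ≤ 4n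
-- and ℓ² ≤ 4n turn this exponent into (24c + 12cs)n.
exponent-choice : ∀ s c n → n ≥ 1 → Σ ℕ λ k →
  (length (range (n ^ s)) * 6 ^ k ℕ.≤ 8 ^ k) × ((n ^ c) ^ k ℕ.≤ (2 ^ (24 * c + 12 * (c * s))) ^ n)
exponent-choice s c n n≥1 with binary-bound n n≥1
... | ℓ , n≤2^ℓ , 2^ℓ≤2n = 3 * j ,
  (begin
    length (range (n ^ s)) * 6 ^ (3 * j)  ≤⟨ ℕ.*-monoˡ-≤ (6 ^ (3 * j)) length≤ ⟩
    2 ^ j * 6 ^ (3 * j)                   ≤⟨ 2^j*6^3j≤8^3j j ⟩
    8 ^ (3 * j)                           ∎) ,
  (begin
    (n ^ c) ^ (3 * j)                     ≡⟨ ℕ.^-*-assoc n c (3 * j) ⟩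
    n ^ (c * (3 * j))                     ≤⟨ ℕ.^-monoˡ-≤ (c * (3 * j)) n≤2^ℓ ⟩
    (2 ^ ℓ) ^ (c * (3 * j))               ≡⟨ ℕ.^-*-assoc 2 ℓ (c * (3 * j)) ⟩
    2 ^ (ℓ * (c * (3 * j)))               ≤⟨ ℕ.^-monoʳ-≤ 2 exponent≤ ⟩
    2 ^ ((24 * c + 12 * (c * s)) * n)     ≡⟨ ℕ.^-*-assoc 2 (24 * c + 12 * (c * s)) n ⟨
    (2 ^ (24 * c + 12 * (c * s))) ^ n     ∎)
  where
  open ℕ.≤-Reasoning
  -- The range has 2nˢ + 1 elements, at most 3 · 2^(ℓs) and hence at most 2ʲ.
  j = 2 + ℓ * s
  ℓ²≤4n : ℓ * ℓ ℕ.≤ 4 * n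
  ℓ²≤4n = ℕ.≤-trans (square≤ ℓ)
    (ℕ.≤-trans (ℕ.*-monoʳ-≤ 2 2^ℓ≤2n) (ℕ.≤-reflexive (sym (ℕ.*-assoc 2 2 n))))
  ℓ≤4n : ℓ ℕ.≤ 4 * n
  ℓ≤4n = ℕ.≤-trans (m≤m*m ℓ) ℓ²≤4n
    where
    m≤m*m : ∀ m → m ℕ.≤ m * m
    m≤m*m zero    = z≤n
    m≤m*m (suc m) = ℕ.m≤m*n (suc m) (suc m)
  length≤ : length (range (n ^ s)) ℕ.≤ 2 ^ j
  length≤ = begin
    length (range (n ^ s))  ≡⟨ length-range (n ^ s) ⟩
    1 + (n ^ s + n ^ s)     ≤⟨ ℕ.+-mono-≤ (ℕ.m^n>0 2 (ℓ * s)) (ℕ.+-mono-≤ power≤ power≤) ⟩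
    x + (x + x)             ≤⟨ ℕ.m≤m+n _ x ⟩
    x + (x + x) + x         ≡⟨ four x ⟩
    2 * (2 * x)             ∎
    where
    x = 2 ^ (ℓ * s)
    power≤ : n ^ s ℕ.≤ x
    power≤ = subst (n ^ s ℕ.≤_) (ℕ.^-*-assoc 2 ℓ s) (ℕ.^-monoˡ-≤ s n≤2^ℓ)
    four : ∀ x → x + (x + x) + x ≡ 2 * (2 * x)
    four = solveℕ-∀
  exponent≤ : ℓ * (c * (3 * j)) ℕ.≤ (24 * c + 12 * (c * s)) * n
  exponent≤ = begin
    ℓ * (c * (3 * j))                            ≡⟨ expand ℓ c s ⟩
    6 * c * ℓ + 3 * (c * s) * (ℓ * ℓ)            ≤⟨ ℕ.+-mono-≤ (ℕ.*-monoʳ-≤ (6 * c) ℓ≤4n)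
                                                                (ℕ.*-monoʳ-≤ (3 * (c * s)) ℓ²≤4n) ⟩
    6 * c * (4 * n) + 3 * (c * s) * (4 * n)      ≡⟨ collect c s n ⟩
    (24 * c + 12 * (c * s)) * n                  ∎
    where
    expand : ∀ ℓ c s → ℓ * (c * (3 * (2 + ℓ * s))) ≡ 6 * c * ℓ + 3 * (c * s) * (ℓ * ℓ)
    expand = solveℕ-∀
    collect : ∀ c s n → 6 * c * (4 * n) + 3 * (c * s) * (4 * n) ≡ (24 * c + 12 * (c * s)) * n
    collect = solveℕ-∀

-- Rational arithmetic and the count

toℚᵘ-ℕtoℚ : ∀ m → Q.toℚᵘ (ℕtoℚ m) ℚᵘ.≃ ℚᵘ.mkℚᵘ (+ m) 0
toℚᵘ-ℕtoℚ m = ℚ.toℚᵘ-fromℚᵘ (ℚᵘ.mkℚᵘ (+ m) 0)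

ℕtoℚ-+ : ∀ m n → ℕtoℚ (m + n) ≡ ℕtoℚ m Q.+ ℕtoℚ n
ℕtoℚ-+ m n = ℚ.toℚᵘ-injective (begin
  Q.toℚᵘ (ℕtoℚ (m + n))                       ≈⟨ toℚᵘ-ℕtoℚ (m + n) ⟩
  ℚᵘ.mkℚᵘ (+ (m + n)) 0                       ≈⟨ ℚᵘ.*≡* (cong (λ u → u ℤ.* 1ℤ)
                                                   (sym (cong₂ ℤ._+_ (ℤ.*-identityʳ (+ m)) (ℤ.*-identityʳ (+ n))))) ⟩
  ℚᵘ.mkℚᵘ (+ m) 0 ℚᵘ.+ ℚᵘ.mkℚᵘ (+ n) 0        ≈⟨ ℚᵘ.+-cong (toℚᵘ-ℕtoℚ m) (toℚᵘ-ℕtoℚ n) ⟨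
  Q.toℚᵘ (ℕtoℚ m) ℚᵘ.+ Q.toℚᵘ (ℕtoℚ n)        ≈⟨ ℚ.toℚᵘ-homo-+ (ℕtoℚ m) (ℕtoℚ n) ⟨
  Q.toℚᵘ (ℕtoℚ m Q.+ ℕtoℚ n)                  ∎)
  where open ℚᵘ.≃-Reasoning

ℕtoℚ-* : ∀ m n → ℕtoℚ (m * n) ≡ ℕtoℚ m Q.* ℕtoℚ n
ℕtoℚ-* m n = ℚ.toℚᵘ-injective (begin
  Q.toℚᵘ (ℕtoℚ (m * n))                       ≈⟨ toℚᵘ-ℕtoℚ (m * n) ⟩
  ℚᵘ.mkℚᵘ (+ (m * n)) 0                       ≈⟨ ℚᵘ.*≡* (cong (λ u → u ℤ.* 1ℤ) (ℤ.pos-* m n)) ⟩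
  ℚᵘ.mkℚᵘ (+ m) 0 ℚᵘ.* ℚᵘ.mkℚᵘ (+ n) 0        ≈⟨ ℚᵘ.*-cong (toℚᵘ-ℕtoℚ m) (toℚᵘ-ℕtoℚ n) ⟨
  Q.toℚᵘ (ℕtoℚ m) ℚᵘ.* Q.toℚᵘ (ℕtoℚ n)        ≈⟨ ℚ.toℚᵘ-homo-* (ℕtoℚ m) (ℕtoℚ n) ⟨
  Q.toℚᵘ (ℕtoℚ m Q.* ℕtoℚ n)                  ∎)
  where open ℚᵘ.≃-Reasoning

ℕtoℚ-mono : ∀ {m n} → m ℕ.≤ n → ℕtoℚ m ≤ ℕtoℚ n
ℕtoℚ-mono {m} {n} m≤n = ℚ.toℚᵘ-cancel-≤ (begin
  Q.toℚᵘ (ℕtoℚ m)  ≃⟨ toℚᵘ-ℕtoℚ m ⟩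
  ℚᵘ.mkℚᵘ (+ m) 0  ≤⟨ ℚᵘ.*≤* (ℤ.*-monoʳ-≤-nonNeg 1ℤ (ℤ.+≤+ m≤n)) ⟩
  ℚᵘ.mkℚᵘ (+ n) 0  ≃⟨ toℚᵘ-ℕtoℚ n ⟨
  Q.toℚᵘ (ℕtoℚ n)  ∎)
  where open ℚᵘ.≤-Reasoning

ℕtoℚ-^ : ∀ m n → ℕtoℚ (m ^ n) ≡ ℕtoℚ m ^ℚ n
ℕtoℚ-^ m zero    = refl
ℕtoℚ-^ m (suc n) = trans (ℕtoℚ-* m (m ^ n)) (cong (ℕtoℚ m Q.*_) (ℕtoℚ-^ m n))

0≤ℕtoℚ : ∀ m → 0ℚ ≤ ℕtoℚ m
0≤ℕtoℚ m = ℕtoℚ-mono {0} {m} z≤n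

*-mono-≤ : ∀ {p q u v} → 0ℚ ≤ p → 0ℚ ≤ v → p ≤ q → u ≤ v → p Q.* u ≤ q Q.* v
*-mono-≤ {p} {q} {u} {v} 0≤p 0≤v p≤q u≤v = ℚ.≤-trans
  (ℚ.*-monoˡ-≤-nonNeg p {{Q.nonNegative 0≤p}} u≤v)
  (ℚ.*-monoʳ-≤-nonNeg v {{Q.nonNegative 0≤v}} p≤q)

0≤-* : ∀ {p q} → 0ℚ ≤ p → 0ℚ ≤ q → 0ℚ ≤ p Q.* q
0≤-* {p} {q} 0≤p 0≤q = subst (_≤ p Q.* q) (ℚ.*-zeroʳ p)
  (ℚ.*-monoˡ-≤-nonNeg p {{Q.nonNegative 0≤p}} 0≤q)

0≤-^ : ∀ {p} → 0ℚ ≤ p → ∀ n → 0ℚ ≤ p ^ℚ n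
0≤-^ 0≤p zero    = 0≤ℕtoℚ 1
0≤-^ 0≤p (suc n) = 0≤-* 0≤p (0≤-^ 0≤p n)

^ℚ-mono : ∀ {p q} → 0ℚ ≤ p → p ≤ q → ∀ n → p ^ℚ n ≤ q ^ℚ n
^ℚ-mono 0≤p p≤q zero    = ℚ.≤-refl
^ℚ-mono 0≤p p≤q (suc n) =
  *-mono-≤ 0≤p (0≤-^ (ℚ.≤-trans 0≤p p≤q) n) p≤q (^ℚ-mono 0≤p p≤q n)

1^ℚ : ∀ n → 1ℚ ^ℚ n ≡ 1ℚ
1^ℚ zero    = refl
1^ℚ (suc n) = trans (ℚ.*-identityˡ (1ℚ ^ℚ n)) (1^ℚ n)

^ℚ-+ : ∀ p m n → p ^ℚ (m + n) ≡ p ^ℚ m Q.* p ^ℚ n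
^ℚ-+ p zero    n = sym (ℚ.*-identityˡ (p ^ℚ n))
^ℚ-+ p (suc m) n = trans (cong (p Q.*_) (^ℚ-+ p m n)) (sym (ℚ.*-assoc p (p ^ℚ m) (p ^ℚ n)))

^ℚ-* : ∀ p q n → (p Q.* q) ^ℚ n ≡ p ^ℚ n Q.* q ^ℚ n
^ℚ-* p q zero    = refl
^ℚ-* p q (suc n) = trans (cong (p Q.* q Q.*_) (^ℚ-* p q n)) (interchange p q (p ^ℚ n) (q ^ℚ n))

markov : ∀ {X : Set} (p : X → Bool) (f : X → ℕ) c → ∀ {xs} →
  All (λ x → T (p x) → c ≤ ℕtoℚ (f x)) xs →
  ℕtoℚ (length (filterᵇ p xs)) Q.* c ≤ ℕtoℚ (sum (map f xs))
markov p f c []                = ℚ.≤-reflexive (ℚ.*-zeroˡ c)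
markov p f c {x ∷ xs} (h ∷ hs) with p x
... | true  = begin
  ℕtoℚ (suc N) Q.* c                 ≡⟨ cong (Q._* c) (ℕtoℚ-+ 1 N) ⟩
  (1ℚ Q.+ ℕtoℚ N) Q.* c              ≡⟨ ℚ.*-distribʳ-+ c 1ℚ (ℕtoℚ N) ⟩
  1ℚ Q.* c Q.+ ℕtoℚ N Q.* c          ≡⟨ cong (Q._+ ℕtoℚ N Q.* c) (ℚ.*-identityˡ c) ⟩
  c Q.+ ℕtoℚ N Q.* c                 ≤⟨ ℚ.+-mono-≤ (h _) (markov p f c hs) ⟩
  ℕtoℚ (f x) Q.+ ℕtoℚ (sum (map f xs)) ≡⟨ ℕtoℚ-+ (f x) (sum (map f xs)) ⟨
  ℕtoℚ (f x + sum (map f xs))        ∎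
  where
  open ℚ.≤-Reasoning
  N = length (filterᵇ p xs)
... | false = ℚ.≤-trans (markov p f c hs) (ℕtoℚ-mono (ℕ.m≤n+m (sum (map f xs)) (f x)))

multisets-length : ∀ vs n → All (λ A → length A ≡ n) (multisets vs n)
multisets-length vs       zero    = refl ∷ []
multisets-length []       (suc n) = []
multisets-length (v ∷ vs) (suc n) =
  All.++⁺ (All.map⁺ (All.map (cong suc) (multisets-length (v ∷ vs) n)))
          (multisets-length vs (suc n))

½^*8^ : ∀ n → ((+ 1) Q./ 2) ^ℚ n Q.* ℕtoℚ (8 ^ n) ≡ ℕtoℚ (4 ^ n)
½^*8^ n = begin
  ½ ^ℚ n Q.* ℕtoℚ (8 ^ n)   ≡⟨ cong (½ ^ℚ n Q.*_) (ℕtoℚ-^ 8 n) ⟩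
  ½ ^ℚ n Q.* ℕtoℚ 8 ^ℚ n    ≡⟨ ^ℚ-* ½ (ℕtoℚ 8) n ⟨
  -- The product of 1/2 and 8 evaluates to 4.
  ℕtoℚ 4 ^ℚ n               ≡⟨ ℕtoℚ-^ 4 n ⟨
  ℕtoℚ (4 ^ n)              ∎
  where
  open ≡-Reasoning
  ½ = (+ 1) Q./ 2

ρ≤lazy : ∀ A → ρ A Q.* ℕtoℚ (8 ^ length A) ≤ ℕtoℚ (lazy A 0ℤ)
ρ≤lazy A = begin
  ℕtoℚ (maxAtom A) Q.* ((+ 1) Q./ 2) ^ℚ n Q.* ℕtoℚ (8 ^ n)
    ≡⟨ ℚ.*-assoc (ℕtoℚ (maxAtom A)) (((+ 1) Q./ 2) ^ℚ n) (ℕtoℚ (8 ^ n)) ⟩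
  ℕtoℚ (maxAtom A) Q.* (((+ 1) Q./ 2) ^ℚ n Q.* ℕtoℚ (8 ^ n))
    ≡⟨ cong (ℕtoℚ (maxAtom A) Q.*_) (½^*8^ n) ⟩
  ℕtoℚ (maxAtom A) Q.* ℕtoℚ (4 ^ n)
    ≡⟨ ℚ.*-comm (ℕtoℚ (maxAtom A)) (ℕtoℚ (4 ^ n)) ⟩
  ℕtoℚ (4 ^ n) Q.* ℕtoℚ (maxAtom A)
    ≡⟨ ℕtoℚ-* (4 ^ n) (maxAtom A) ⟨
  ℕtoℚ (4 ^ n * maxAtom A)
    ≤⟨ ℕtoℚ-mono (maxAtom≤lazy A) ⟩
  ℕtoℚ (lazy A 0ℤ) ∎
  where
  open ℚ.≤-Reasoning
  n = length A

-- Markov's inequality for the moment of order n + k. As `lazy` at 0 is 8ⁿ U, both sides carry the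
-- factor `E`, which is cancelled.
count-bound : ∀ n s t r → 0ℚ ≤ r → ∀ k → length (range (n ^ s)) * 6 ^ k ℕ.≤ 8 ^ k →
  ℕtoℚ (count n s t r) Q.* r ^ℚ (n + k) ≤ ℕtoℚ (2 ^ n)
count-bound n s t r 0≤r k few =
  ℚ.*-cancelʳ-≤-pos E {{Q.positive 0<E}} (begin
    N Q.* r ^ℚ m Q.* E                  ≡⟨ ℚ.*-assoc N (r ^ℚ m) E ⟩
    N Q.* (r ^ℚ m Q.* E)                ≡⟨ cong (λ u → N Q.* (r ^ℚ m Q.* u)) E≡ ⟩
    N Q.* (r ^ℚ m Q.* ℕtoℚ (8 ^ n) ^ℚ m) ≡⟨ cong (N Q.*_) (^ℚ-* r (ℕtoℚ (8 ^ n)) m) ⟨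
    N Q.* (r Q.* ℕtoℚ (8 ^ n)) ^ℚ m     ≤⟨ markov _ (λ A → lazy A 0ℤ ^ m) _
                                             (All.map (λ {A} → heavy A) (multisets-length (range (n ^ s)) n)) ⟩
    ℕtoℚ (sum (map (λ A → lazy A 0ℤ ^ m) (multisets (range (n ^ s)) n)))
                                        ≤⟨ ℕtoℚ-mono (ℕ.≤-trans
                                             (sum-multisets≤seqSum (range (n ^ s)) n _)
                                             (seqSum-lazy-power≤ (range-unique (n ^ s)) k few n)) ⟩
    ℕtoℚ (2 ^ n * 8 ^ (n * m))          ≡⟨ ℕtoℚ-* (2 ^ n) (8 ^ (n * m)) ⟩
    ℕtoℚ (2 ^ n) Q.* E                  ∎)
  where
  open ℚ.≤-Reasoning
  m = n + k
  N = ℕtoℚ (count n s t r)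
  E = ℕtoℚ (8 ^ (n * m))
  E≡ : E ≡ ℕtoℚ (8 ^ n) ^ℚ m
  E≡ = trans (cong ℕtoℚ (sym (ℕ.^-*-assoc 8 n m))) (ℕtoℚ-^ (8 ^ n) m)
  0<E : 0ℚ < E
  0<E = ℚ.<-≤-trans (ℚ.positive⁻¹ 1ℚ) (ℕtoℚ-mono (ℕ.m^n>0 8 (n * m)))
  heavy : ∀ A → length A ≡ n → T (allᵇ (boundedᵇ n s t) A ∧ (r Q.≤ᵇ ρ A)) →
    (r Q.* ℕtoℚ (8 ^ n)) ^ℚ m ≤ ℕtoℚ (lazy A 0ℤ ^ m)
  heavy A refl counted = begin
    (r Q.* ℕtoℚ (8 ^ length A)) ^ℚ m
      ≤⟨ ^ℚ-mono (0≤-* 0≤r (0≤ℕtoℚ (8 ^ length A)))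
           (ℚ.≤-trans scaled (ρ≤lazy A)) m ⟩
    ℕtoℚ (lazy A 0ℤ) ^ℚ m
      ≡⟨ ℕtoℚ-^ (lazy A 0ℤ) m ⟨
    ℕtoℚ (lazy A 0ℤ ^ m) ∎
    where
    r≤ρ : r ≤ ρ A
    r≤ρ = ℚ.≤ᵇ⇒≤ (proj₂ (Equivalence.to (T-∧ {allᵇ (boundedᵇ n s t) A} {r Q.≤ᵇ ρ A}) counted))
    scaled : r Q.* ℕtoℚ (8 ^ length A) ≤ ρ A Q.* ℕtoℚ (8 ^ length A)
    scaled = ℚ.*-monoʳ-≤-nonNeg (ℕtoℚ (8 ^ length A))
      {{Q.nonNegative (0≤ℕtoℚ (8 ^ length A))}} {r} {ρ A} r≤ρ

-- Replaces the lower bound r ≥ n^(-c/d) by the weaker r ≥ n^(-c), which involves no root. If r ≤ 1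
-- then rᵈ ≤ r, since d ≥ 1; otherwise both factors of rx are at least 1.
1≤root : ∀ {r x} → 0ℚ ≤ r → 1ℚ ≤ x → ∀ d → d ≥ 1 → 1ℚ ≤ r ^ℚ d Q.* x → 1ℚ ≤ r Q.* x
1≤root {r} {x} 0≤r 1≤x (suc d) _ 1≤rᵈx with ℚ.≤-total r 1ℚ
... | inj₁ r≤1 = ℚ.≤-trans 1≤rᵈx (ℚ.*-monoʳ-≤-nonNeg x {{Q.nonNegative 0≤x}} (begin
  r Q.* r ^ℚ d    ≤⟨ ℚ.*-monoˡ-≤-nonNeg r {{Q.nonNegative 0≤r}} (^ℚ-mono 0≤r r≤1 d) ⟩
  r Q.* 1ℚ ^ℚ d   ≡⟨ cong (r Q.*_) (1^ℚ d) ⟩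
  r Q.* 1ℚ        ≡⟨ ℚ.*-identityʳ r ⟩
  r               ∎))
  where
  open ℚ.≤-Reasoning
  0≤x = ℚ.≤-trans (0≤ℕtoℚ 1) 1≤x
... | inj₂ 1≤r = *-mono-≤ (0≤ℕtoℚ 1) (ℚ.≤-trans (0≤ℕtoℚ 1) 1≤x) 1≤r 1≤x

-- Multiplying by (rx)ᵏ ≥ 1 with x = nᶜ supplies the missing rᵏ for `count-bound`, and xᵏ is at most
-- exponential in n by the choice of k.
count*r^n≤ : ∀ s t c d n → d ≥ 1 → n ≥ 1 → ∀ r → 0ℚ ≤ r → 1ℚ ≤ r ^ℚ d Q.* ℕtoℚ n ^ℚ c →
  ℕtoℚ (count n s t r) Q.* r ^ℚ n ≤ ℕtoℚ ((2 * 2 ^ (24 * c + 12 * (c * s))) ^ n)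
count*r^n≤ s t c d n d≥1 n≥1 r 0≤r large = begin
  N Q.* r ^ℚ n
    ≡⟨ ℚ.*-identityʳ (N Q.* r ^ℚ n) ⟨
  N Q.* r ^ℚ n Q.* 1ℚ
    ≡⟨ cong (N Q.* r ^ℚ n Q.*_) (1^ℚ k) ⟨
  N Q.* r ^ℚ n Q.* 1ℚ ^ℚ k
    ≤⟨ ℚ.*-monoˡ-≤-nonNeg (N Q.* r ^ℚ n) {{Q.nonNegative (0≤-* (0≤ℕtoℚ (count n s t r)) (0≤-^ 0≤r n))}}
         (^ℚ-mono (0≤ℕtoℚ 1) (1≤root 0≤r 1≤x d d≥1 large) k) ⟩
  N Q.* r ^ℚ n Q.* (r Q.* x) ^ℚ k
    ≡⟨ cong (N Q.* r ^ℚ n Q.*_) (^ℚ-* r x k) ⟩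
  N Q.* r ^ℚ n Q.* (r ^ℚ k Q.* x ^ℚ k)
    ≡⟨ ℚ.*-assoc (N Q.* r ^ℚ n) (r ^ℚ k) (x ^ℚ k) ⟨
  N Q.* r ^ℚ n Q.* r ^ℚ k Q.* x ^ℚ k
    ≡⟨ cong (Q._* x ^ℚ k) (trans (ℚ.*-assoc N (r ^ℚ n) (r ^ℚ k)) (cong (N Q.*_) (sym (^ℚ-+ r n k)))) ⟩
  N Q.* r ^ℚ (n + k) Q.* x ^ℚ k
    ≤⟨ *-mono-≤ (0≤-* (0≤ℕtoℚ (count n s t r)) (0≤-^ 0≤r (n + k))) (0≤ℕtoℚ (K₁ ^ n))
         (count-bound n s t r 0≤r k few) x^k≤ ⟩
  ℕtoℚ (2 ^ n) Q.* ℕtoℚ (K₁ ^ n)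
    ≡⟨ ℕtoℚ-* (2 ^ n) (K₁ ^ n) ⟨
  ℕtoℚ (2 ^ n * K₁ ^ n)
    ≡⟨ cong ℕtoℚ (^-distrib-* 2 K₁ n) ⟨
  ℕtoℚ ((2 * K₁) ^ n) ∎
  where
  open ℚ.≤-Reasoning
  k = proj₁ (exponent-choice s c n n≥1)
  few = proj₁ (proj₂ (exponent-choice s c n n≥1))
  n^ck≤ = proj₂ (proj₂ (exponent-choice s c n n≥1))
  N = ℕtoℚ (count n s t r)
  K₁ = 2 ^ (24 * c + 12 * (c * s))
  x = ℕtoℚ n ^ℚ c
  x≡ : ℕtoℚ (n ^ c) ≡ x
  x≡ = ℕtoℚ-^ n c
  1≤x : 1ℚ ≤ x
  1≤x = subst (1ℚ ≤_) x≡ (ℕtoℚ-mono (subst (ℕ._≤ n ^ c) (ℕ.^-zeroˡ c) (ℕ.^-monoˡ-≤ c n≥1)))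
  x^k≤ : x ^ℚ k ≤ ℕtoℚ (K₁ ^ n)
  x^k≤ = subst (_≤ ℕtoℚ (K₁ ^ n)) (trans (ℕtoℚ-^ (n ^ c) k) (cong (_^ℚ k) x≡)) (ℕtoℚ-mono n^ck≤)

square-^ : ∀ m n → (m ^ n) ^ 2 ≡ m ^ (2 * n)
square-^ m n = trans (ℕ.^-*-assoc m n 2) (cong (m ^_) (ℕ.*-comm n 2))

mainTheorem1 : (ε : ℚ) → 0ℚ < ε → ε < 1ℚ →
    Σ ℕ λ L →
    (s t c d : ℕ) → s ≥ 1 → t ≥ 1 → c ≥ 1 → d ≥ 1 →
    Σ ℕ λ K →
    (n : ℕ) → n ≥ 1 → (r : ℚ) → 0ℚ < r →
    1ℚ ≤ (r ^ℚ d) Q.* (ℕtoℚ n ^ℚ c) →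
    (ℕtoℚ (count n s t r) ^ℚ 2) Q.* (r ^ℚ (2 * n)) Q.* (ℕtoℚ n ^ℚ n)
    ≤ ℕtoℚ ((K ^ (2 * n)) * (n ^ (2 * (L * n))))
-- In `K` the first factor 2 comes from the moment bound and the power of 2 from estimating n^(ck).
mainTheorem1 ε _ _ = 1 , λ s t c d _ _ _ d≥1 → 2 * 2 ^ (24 * c + 12 * (c * s)) ,
  λ n n≥1 r 0<r large → bound s t c d d≥1 n n≥1 r (ℚ.<⇒≤ 0<r) large
  where
  bound : ∀ s t c d → d ≥ 1 → ∀ n → n ≥ 1 → ∀ r → 0ℚ ≤ r → 1ℚ ≤ r ^ℚ d Q.* ℕtoℚ n ^ℚ c →
    ℕtoℚ (count n s t r) ^ℚ 2 Q.* r ^ℚ (2 * n) Q.* ℕtoℚ n ^ℚ n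
    ≤ ℕtoℚ ((2 * 2 ^ (24 * c + 12 * (c * s))) ^ (2 * n) * n ^ (2 * (1 * n)))
  -- The claim is the desired bound squared and cleared of denominators. Squaring N rⁿ ≤ Kⁿ handles
  -- everything but nⁿ, which L = 1 absorbs as nⁿ ≤ n²ⁿ.
  bound s t c d d≥1 n n≥1 r 0≤r large = begin
    N ^ℚ 2 Q.* r ^ℚ (2 * n) Q.* ℕtoℚ n ^ℚ n
      ≡⟨ cong (λ u → N ^ℚ 2 Q.* u Q.* ℕtoℚ n ^ℚ n) r^2n≡ ⟩
    N ^ℚ 2 Q.* (r ^ℚ n) ^ℚ 2 Q.* ℕtoℚ n ^ℚ n
      ≡⟨ cong₂ Q._*_ (^ℚ-* N (r ^ℚ n) 2) (ℕtoℚ-^ n n) ⟨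
    (N Q.* r ^ℚ n) ^ℚ 2 Q.* ℕtoℚ (n ^ n)
      ≤⟨ *-mono-≤ (0≤-^ 0≤Nrⁿ 2) (0≤ℕtoℚ (n ^ (2 * (1 * n))))
           (^ℚ-mono 0≤Nrⁿ (count*r^n≤ s t c d n d≥1 n≥1 r 0≤r large) 2)
           (ℕtoℚ-mono n^n≤) ⟩
    ℕtoℚ (K ^ n) ^ℚ 2 Q.* ℕtoℚ (n ^ (2 * (1 * n)))
      ≡⟨ cong (Q._* ℕtoℚ (n ^ (2 * (1 * n))))
           (trans (sym (ℕtoℚ-^ (K ^ n) 2)) (cong ℕtoℚ (square-^ K n))) ⟩
    ℕtoℚ (K ^ (2 * n)) Q.* ℕtoℚ (n ^ (2 * (1 * n)))
      ≡⟨ ℕtoℚ-* (K ^ (2 * n)) (n ^ (2 * (1 * n))) ⟨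
    ℕtoℚ (K ^ (2 * n) * n ^ (2 * (1 * n))) ∎
    where
    open ℚ.≤-Reasoning
    N = ℕtoℚ (count n s t r)
    K = 2 * 2 ^ (24 * c + 12 * (c * s))
    0≤Nrⁿ = 0≤-* (0≤ℕtoℚ (count n s t r)) (0≤-^ 0≤r n)
    r^2n≡ : r ^ℚ (2 * n) ≡ (r ^ℚ n) ^ℚ 2
    r^2n≡ = trans (^ℚ-+ r n (n + 0)) (cong (r ^ℚ n Q.*_) (trans (^ℚ-+ r n 0) refl))
    n^n≤ : n ^ n ℕ.≤ n ^ (2 * (1 * n))
    n^n≤ = ℕ.^-monoʳ-≤ n {{ℕ.>-nonZero n≥1}}
      (ℕ.≤-trans (ℕ.m≤n*m n 2) (ℕ.≤-reflexive (cong (2 *_) (sym (ℕ.*-identityˡ n)))))
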